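{- For each positive integer $r$ there is a positive integer $k$ such that, with probability tending to $1$ as $n\to\infty$, the random hypergraph $\mathcal{H}=\mathcal{K}^{(r)}_n(k\text{ -out})$ admits a perfect fractional matching, and the constant function $w\equiv 1/r$ is the only fractional cover of $\mathcal{H}$ of weight $n/r$.
   Context: An $r$-graph on a vertex set $V$ is a collection of $r$-element subsets (edges) of $V$. $\mathcal{K}^{(r)}_n$ denotes the complete $r$-graph on $V=[n]$ (all $r$-subsets are edges). The $k$-out model: for a host hypergraph $\mathcal{H}$ on $V$, the random subhypergraph $\mathcal{H}(k\text{ -out})$ is $\bigcup_{v\in V}E_v$, where, for each $v$, $E_v$ is chosen uniformly at random from the $k$-element subsets of $\mathcal{H}_v=\{A\in\mathcal{H}: v\in A\}$ (or $E_v=\mathcal{H}_v$ if $|\mathcal{H}_v|<k$), these choices being made independently. A fractional cover of a hypergraph is a map $w:V\to[0,1]$ with $\sum_{v\in e}w(v)\ge 1$ for every edge $e$; its weight is $\sum_v w(v)$. A fractional matching is a map $\varphi$ from the edges to $[0,1]$ with $\sum_{e\ni v}\varphi(e)\le 1$ for all $v\in V$; its weight is $\sum_e\varphi(e)$. A fractional matching of an $r$-graph on $n$ vertices is perfect if its weight is $n/r$ (equivalently $\sum_{e\ni v}\varphi(e)=1$ for all $v$).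
   Formalization: Fractional covers and fractional matchings take rational instead of real values; in particular, the uniqueness of w ≡ 1/r is stated among rational-valued fractional covers of weight n/r. -}

module Defs where

open import Data.Nat as ℕ using (ℕ; suc; _<_; NonZero)
open import Data.Bool.Properties using () renaming (_≟_ to _≟ᵇ_)
open import Data.Fin using (Fin)
open import Data.Fin.Subset using (Subset; _∈_; ∣_∣)
open import Data.Fin.Subset.Properties using (_∈?_)
open import Data.Vec using (Vec; lookup; toList)
open import Data.Vec.Properties using (≡-dec)
open import Data.List using (List; length; map; filter; concat; deduplicate; foldr; allFin)
open import Data.List.Relation.Unary.All using (All)
open import Data.List.Relation.Unary.Unique.Propositional using (Unique)
open import Data.List.Membership.Propositional renaming (_∈_ to _∈ₗ_)
open import Data.Integer using (+_)
open import Data.Rational using (ℚ; 0ℚ; 1ℚ; _+_; _≤_; _/_)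
open import Data.Product using (_×_; ∃)
open import Data.Sum using (_⊎_)
open import Relation.Nullary using (Dec)
open import Relation.Binary.PropositionalEquality using (_≡_)

Σℚ : List ℚ → ℚ
Σℚ = foldr _+_ 0ℚ

_≟ₛ_ : ∀ {n} → (a b : Subset n) → Dec (a ≡ b)
_≟ₛ_ = ≡-dec _≟ᵇ_

IsEdge : (n r : ℕ) → Subset n → Set
IsEdge n r e = ∣ e ∣ ≡ r

-- The k-out model on the host K^(r)_n.
--
-- For a vertex v, E_v is a uniformly random k-subset of
-- H_v = {A ∈ K^(r)_n : v ∈ A}, or E_v = H_v if |H_v| < k.
-- We encode the choice E_v as a duplicate-free list L of edges through v
-- (an ordering of E_v).  Uniform distribution on duplicate-free lists of
-- length k induces the uniform distribution on k-subsets (each k-subset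
-- has exactly k! orderings), and when |H_v| < k every ordering of H_v is
-- taken, so probabilities are unchanged.

ValidChoice : (n r k : ℕ) → Fin n → List (Subset n) → Set
ValidChoice n r k v L =
  Unique L ×
  All (λ e → IsEdge n r e × v ∈ e) L ×
  ( (length L ≡ k)
  ⊎ (length L < k × (∀ e → IsEdge n r e → v ∈ e → e ∈ₗ L)) )

Outcome : ℕ → Set
Outcome n = Vec (List (Subset n)) n

ValidOutcome : (n r k : ℕ) → Outcome n → Set
ValidOutcome n r k ω = ∀ v → ValidChoice n r k v (lookup ω v)

edges : ∀ {n} → Outcome n → List (Subset n)
edges ω = deduplicate _≟ₛ_ (concat (toList ω))

edgesAt : ∀ {n} → List (Subset n) → Fin n → List (Subset n)
edgesAt Es v = filter (v ∈?_) Es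

verticesOf : ∀ {n} → Subset n → List (Fin n)
verticesOf {n} e = filter (_∈? e) (allFin n)

IsFractionalMatching : ∀ {n} → List (Subset n) → (Subset n → ℚ) → Set
IsFractionalMatching {n} Es φ =
  All (λ e → 0ℚ ≤ φ e × φ e ≤ 1ℚ) Es ×
  (∀ (v : Fin n) → Σℚ (map φ (edgesAt Es v)) ≤ 1ℚ)

matchingWeight : ∀ {n} → List (Subset n) → (Subset n → ℚ) → ℚ
matchingWeight Es φ = Σℚ (map φ Es)

IsPerfectFractionalMatching : (n r : ℕ) .{{_ : NonZero r}} →
  List (Subset n) → (Subset n → ℚ) → Set
IsPerfectFractionalMatching n r Es φ =
  IsFractionalMatching Es φ × matchingWeight Es φ ≡ (+ n) / r

IsFractionalCover : ∀ {n} → List (Subset n) → (Fin n → ℚ) → Set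
IsFractionalCover {n} Es w =
  (∀ (v : Fin n) → 0ℚ ≤ w v × w v ≤ 1ℚ) ×
  All (λ e → 1ℚ ≤ Σℚ (map w (verticesOf e))) Es

coverWeight : (n : ℕ) → (Fin n → ℚ) → ℚ
coverWeight n w = Σℚ (map w (allFin n))

GoodProperty : (n r : ℕ) .{{_ : NonZero r}} → List (Subset n) → Set
GoodProperty n r Es =
  (∃ λ φ → IsPerfectFractionalMatching n r Es φ) ×
  IsFractionalCover Es (λ _ → (+ 1) / r) ×
  (∀ w → IsFractionalCover Es w → coverWeight n w ≡ (+ n) / r →
     ∀ v → w v ≡ (+ 1) / r)

-- "With probability at least 1 - 1/(m+1)":
-- the (finitely many, equally likely) valid outcomes are listed without
-- repetition as Good ++ Bad, every Good outcome has the property, and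
-- (m+1)·|Bad| ≤ |Good ++ Bad|.  (Bad may also contain outcomes with the
-- property; this only makes the condition weaker than needed, and it is
-- equivalent to P(property) ≥ 1 - 1/(m+1).)

ProbAtLeast : (n r k m : ℕ) → (Outcome n → Set) → Set
ProbAtLeast n r k m P =
  ∃ λ (Good : List (Outcome n)) → ∃ λ (Bad : List (Outcome n)) →
    Unique (Good Data.List.++ Bad) ×
    All (ValidOutcome n r k) (Good Data.List.++ Bad) ×
    (∀ ω → ValidOutcome n r k ω → ω ∈ₗ (Good Data.List.++ Bad)) ×
    All P Good ×
    suc m ℕ.* length Bad ℕ.≤ length (Good Data.List.++ Bad)

{-# OPTIONS --safe #-}

-- Call a pair (S , U) of disjoint vertex sets with S nonempty and |U| ≤ r |S| an obstruction if every chosen edge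
-- meeting S also meets U.
--
-- Suppose there is no obstruction and let g be a weighting of the vertices that is nonnegative on every edge.  For t ≥ 0
-- the sets {g < -rt} and {g > t} are not an obstruction, because an edge meeting the first and avoiding the second
-- would have negative weight; hence |{g > t}| > r |{g < -rt}| whenever the latter set is nonempty.  Summing over t gives
-- Σ g ≥ 0, with equality only for g = 0.  By Farkas' lemma the first conclusion yields a perfect fractional
-- matching, and the second, applied to a multiple of w - 1/r, shows that the cover 1/r is unique.
--
-- Obstructions are excluded by a union bound.  For |S| = a the number of pairs is at most (16 (n/a)^(r+1))^a.  For
-- v ∈ S a random edge through v meets U with probability ρ satisfying both ρ ≤ K a/n and ρ ≤ 1 - c for constants K and c,
-- so a bounded number of edges push the probability that all of them meet U below any small multiple of (a/n)^(r+3).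
-- With k chosen accordingly the failure probability for each a is at most 1/n², and 1/n in total.
module Submission where

open import Defs
open import Data.Nat using (ℕ; _≥_; NonZero)
open import Data.Product using (∃; _×_)

-- The factor `r` acts twice in the choice of levels. An edge with one vertex below `- r t` and its
-- other `r - 1` vertices at most `t` has weight below `- t`. And since the lower levels are spaced
-- `r` apart, the sum of `r |{g < - r t}|` over `t` still covers the whole negative part of `g`,
-- while the sum of `|{g > t}|` stays within the positive part. This is why an obstruction allows
-- `|U|` up to `r |S|`.
--
-- Edges meeting `S` may be drawn by any of their vertices; the estimate uses only those drawn by
-- vertices of `S`. This enlarges the bad event but makes it an intersection of independent events,
-- one for each vertex of `S`.
--
-- Neither bound on `ρ` suffices alone: `K a / n` may exceed `1` when `a` is of order `n`, and
-- `1 - c` does not decay with `n` when `a` is bounded. In the exponent `r + 3`, `r + 1` pays for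
-- the number of pairs and `2` yields the final `1/n²`. Probabilities are ratios of list lengths,
-- and inequalities between them are cross-multiplied in the natural numbers.

-- Bernoulli-type estimates and binomial coefficients.

module Arithmetic where

  open import Data.Nat
  open import Data.Nat.Properties
  open import Data.Nat.Combinatorics using (_C_; nC1≡n; nCk+nC[k+1]≡[n+1]C[k+1])
  open import Data.Nat.Tactic.RingSolver using (solve-∀)
  open import Data.Sum using (inj₁; inj₂)
  open import Relation.Binary.PropositionalEquality using (_≡_; refl; sym; trans; cong; cong₂)

  open ≤-Reasoning

  ^-distribʳ-* : ∀ m n o → (m * n) ^ o ≡ m ^ o * n ^ o
  ^-distribʳ-* m n zero = refl
  ^-distribʳ-* m n (suc o) rewrite ^-distribʳ-* m n o = interchange m n (m ^ o) (n ^ o)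
    where
    interchange : ∀ a b c d → a * b * (c * d) ≡ a * c * (b * d)
    interchange = solve-∀

  -- Bernoulli's inequality `(1 + 1/x)^i ≥ 1 + i/x` with denominators cleared, which also admits
  -- `x = 0`.
  bernoulli : ∀ x i → x ^ i * (x + i) ≤ x * suc x ^ i
  bernoulli x zero = ≤-reflexive (lemma x)
    where
    lemma : ∀ x → 1 * (x + 0) ≡ x * 1
    lemma = solve-∀
  bernoulli x (suc i) = begin
    x * x ^ i * (x + suc i)           ≤⟨ m≤m+n _ (x ^ i * i) ⟩
    x * x ^ i * (x + suc i) + x ^ i * i ≡⟨ expand x (x ^ i) i ⟩
    x ^ i * (x + i) * suc x           ≤⟨ *-monoˡ-≤ (suc x) (bernoulli x i) ⟩
    x * suc x ^ i * suc x             ≡⟨ swap x (suc x ^ i) (suc x) ⟩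
    x * (suc x * suc x ^ i)           ∎
    where
    expand : ∀ x y i → x * y * (x + suc i) + y * i ≡ y * (x + i) * suc x
    expand = solve-∀
    swap : ∀ a b c → a * b * c ≡ a * (c * b)
    swap = solve-∀

  -- (1 - 1/(n+1))^j ≥ 1 - j/(n+1); for j > n the truncated subtraction makes it trivial.
  bernoulli⁻ : ∀ n j → suc n ^ j * (suc n ∸ j) ≤ n ^ j * suc n
  bernoulli⁻ n zero = ≤-refl
  bernoulli⁻ n (suc j) with ≤-total n j
  ... | inj₁ n≤j rewrite m≤n⇒m∸n≡0 n≤j | *-zeroʳ (suc n ^ suc j) = z≤n
  ... | inj₂ j≤n = begin
    suc n ^ suc j * (n ∸ j)              ≤⟨ m≤m+n _ (suc n ^ j * j) ⟩
    suc n ^ suc j * (n ∸ j) + suc n ^ j * j ≡⟨ expand (m∸n+n≡m j≤n) (suc n ^ j) ⟩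
    n * (suc n ^ j * suc (n ∸ j))        ≡⟨ cong (λ z → n * (suc n ^ j * z)) (+-∸-assoc 1 j≤n) ⟨
    n * (suc n ^ j * (suc n ∸ j))        ≤⟨ *-monoʳ-≤ n (bernoulli⁻ n j) ⟩
    n * (n ^ j * suc n)                  ≡⟨ *-assoc n (n ^ j) (suc n) ⟨
    n ^ suc j * suc n                    ∎
    where
    expand : ∀ {d} → d + j ≡ n → ∀ y → suc n * y * d + y * j ≡ n * (y * suc d)
    expand {d} refl y = lemma d j y
      where
      lemma : ∀ d j y → suc (d + j) * y * d + y * j ≡ (d + j) * (y * suc d)
      lemma = solve-∀

  -- A substitute for `(1 + 1/n)^n ≤ e`. The exponent is split into two halves, and each contributes
  -- a factor of at most `2`, because `1 - j/(n+1) ≥ 1/2` for `j` up to `⌈n/2⌉`.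
  [1+n]^n≤4*n^n : ∀ n → suc n ^ n ≤ 4 * n ^ n
  [1+n]^n≤4*n^n n = begin
    suc n ^ n                              ≡⟨ halve (suc n) ⟩
    suc n ^ ⌊ n /2⌋ * suc n ^ ⌈ n /2⌉      ≤⟨ *-mono-≤ (half (⌊n/2⌋≤⌈n/2⌉ n)) (half ≤-refl) ⟩
    2 * n ^ ⌊ n /2⌋ * (2 * n ^ ⌈ n /2⌉)    ≡⟨ collect (n ^ ⌊ n /2⌋) (n ^ ⌈ n /2⌉) ⟩
    4 * (n ^ ⌊ n /2⌋ * n ^ ⌈ n /2⌉)        ≡⟨ cong (4 *_) (halve n) ⟨
    4 * n ^ n                              ∎
    where
    halve : ∀ x → x ^ n ≡ x ^ ⌊ n /2⌋ * x ^ ⌈ n /2⌉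
    halve x = trans (cong (x ^_) (sym (⌊n/2⌋+⌈n/2⌉≡n n))) (^-distribˡ-+-* x ⌊ n /2⌋ ⌈ n /2⌉)
    collect : ∀ a b → 2 * a * (2 * b) ≡ 4 * (a * b)
    collect = solve-∀
    2⌈n/2⌉≤1+n : 2 * ⌈ n /2⌉ ≤ suc n
    2⌈n/2⌉≤1+n = begin
      2 * ⌈ n /2⌉             ≡⟨ cong (⌈ n /2⌉ +_) (+-identityʳ _) ⟩
      ⌈ n /2⌉ + ⌈ n /2⌉       ≤⟨ +-monoʳ-≤ ⌈ n /2⌉ (⌊n/2⌋≤⌈n/2⌉ (suc n)) ⟩
      ⌊ suc n /2⌋ + ⌈ suc n /2⌉ ≡⟨ ⌊n/2⌋+⌈n/2⌉≡n (suc n) ⟩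
      suc n                   ∎
    half : ∀ {j} → j ≤ ⌈ n /2⌉ → suc n ^ j ≤ 2 * n ^ j
    half {j} j≤ = *-cancelʳ-≤ _ _ (suc n) (begin
      suc n ^ j * suc n                ≤⟨ *-monoʳ-≤ (suc n ^ j) 1+n≤2[1+n∸j] ⟩
      suc n ^ j * (2 * (suc n ∸ j))    ≡⟨ swap (suc n ^ j) 2 (suc n ∸ j) ⟩
      2 * (suc n ^ j * (suc n ∸ j))    ≤⟨ *-monoʳ-≤ 2 (bernoulli⁻ n j) ⟩
      2 * (n ^ j * suc n)              ≡⟨ *-assoc 2 (n ^ j) (suc n) ⟨
      2 * n ^ j * suc n                ∎)
      where
      swap : ∀ a b c → a * (b * c) ≡ b * (a * c)
      swap = solve-∀
      1+n≤2[1+n∸j] : suc n ≤ 2 * (suc n ∸ j)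
      1+n≤2[1+n∸j] = begin
        suc n                     ≡⟨ m+n∸n≡m (suc n) (suc n) ⟨
        suc n + suc n ∸ suc n     ≤⟨ ∸-monoʳ-≤ (suc n + suc n) (≤-trans (*-monoʳ-≤ 2 j≤) 2⌈n/2⌉≤1+n) ⟩
        suc n + suc n ∸ 2 * j     ≡⟨ cong (λ z → suc n + z ∸ 2 * j) (+-identityʳ (suc n)) ⟨
        2 * suc n ∸ 2 * j         ≡⟨ *-distribˡ-∸ 2 (suc n) j ⟨
        2 * (suc n ∸ j)           ∎

  -- By `bernoulli`, `1 + a/n ≤ (1 + 1/n)^a`; the `n`-th power of the right side is the `a`-th power
  -- of `(1 + 1/n)^n`, which is at most `4`.
  [n+a]^n≤4^a*n^n : ∀ n a .{{_ : NonZero n}} → (n + a) ^ n ≤ 4 ^ a * n ^ n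
  [n+a]^n≤4^a*n^n n a = *-cancelʳ-≤ _ _ ((n ^ a) ^ n) {{m^n≢0 (n ^ a) n {{m^n≢0 n a}}}} (begin
    (n + a) ^ n * (n ^ a) ^ n         ≡⟨ ^-distribʳ-* (n + a) (n ^ a) n ⟨
    ((n + a) * n ^ a) ^ n             ≤⟨ ^-monoˡ-≤ n (≤-trans (≤-reflexive (*-comm (n + a) (n ^ a))) (bernoulli n a)) ⟩
    (n * suc n ^ a) ^ n               ≡⟨ ^-distribʳ-* n (suc n ^ a) n ⟩
    n ^ n * (suc n ^ a) ^ n           ≡⟨ cong (n ^ n *_) (exchange (suc n)) ⟩
    n ^ n * (suc n ^ n) ^ a           ≤⟨ *-monoʳ-≤ (n ^ n) (^-monoˡ-≤ a ([1+n]^n≤4*n^n n)) ⟩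
    n ^ n * (4 * n ^ n) ^ a           ≡⟨ cong (n ^ n *_) (^-distribʳ-* 4 (n ^ n) a) ⟩
    n ^ n * (4 ^ a * (n ^ n) ^ a)     ≡⟨ cong (λ z → n ^ n * (4 ^ a * z)) (exchange n) ⟨
    n ^ n * (4 ^ a * (n ^ a) ^ n)     ≡⟨ swap (n ^ n) (4 ^ a) ((n ^ a) ^ n) ⟩
    4 ^ a * n ^ n * (n ^ a) ^ n       ∎)
    where
    exchange : ∀ x → (x ^ a) ^ n ≡ (x ^ n) ^ a
    exchange x = trans (^-*-assoc x a n) (trans (cong (x ^_) (*-comm a n)) (sym (^-*-assoc x n a)))
    swap : ∀ a b c → a * (b * c) ≡ b * a * c
    swap = solve-∀

  absorption : ∀ n k → (suc n C suc k) * suc k ≡ suc n * (n C k)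
  absorption n zero = cong (_* 1) (nC1≡n (suc n))
  absorption zero (suc k) = refl
  absorption (suc n) (suc k) = begin-equality
    (suc (suc n) C suc (suc k)) * suc (suc k)
      ≡⟨ cong (_* suc (suc k)) (nCk+nC[k+1]≡[n+1]C[k+1] (suc n) (suc k)) ⟨
    (suc n C suc k + suc n C suc (suc k)) * suc (suc k)
      ≡⟨ expand (suc n C suc k) (suc n C suc (suc k)) k ⟩
    suc n C suc k + ((suc n C suc k) * suc k + (suc n C suc (suc k)) * suc (suc k))
      ≡⟨ cong₂ (λ a b → suc n C suc k + (a + b)) (absorption n k) (absorption n (suc k)) ⟩
    suc n C suc k + (suc n * (n C k) + suc n * (n C suc k))
      ≡⟨ cong (suc n C suc k +_) (*-distribˡ-+ (suc n) (n C k) (n C suc k)) ⟨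
    suc n C suc k + suc n * (n C k + n C suc k)
      ≡⟨ cong (λ c → suc n C suc k + suc n * c) (nCk+nC[k+1]≡[n+1]C[k+1] n k) ⟩
    suc (suc n) * (suc n C suc k) ∎
    where
    expand : ∀ a b k → (a + b) * suc (suc k) ≡ a + (a * suc k + b * suc (suc k))
    expand = solve-∀

  C-monoˡ-suc : ∀ n k → n C k ≤ suc n C k
  C-monoˡ-suc n zero = ≤-refl
  C-monoˡ-suc n (suc k) rewrite sym (nCk+nC[k+1]≡[n+1]C[k+1] n k) = m≤n+m _ _

  -- Needed to see that for large `n` at least `k` edges pass through every vertex.
  1+t≤[t+1+s]C[1+s] : ∀ s t → suc t ≤ (t + suc s) C suc s
  1+t≤[t+1+s]C[1+s] s zero = base (suc s)
    where
    base : ∀ s → 1 ≤ s C s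
    base zero = ≤-refl
    base (suc s) rewrite sym (nCk+nC[k+1]≡[n+1]C[k+1] s s) = ≤-trans (base s) (m≤m+n _ _)
  1+t≤[t+1+s]C[1+s] s (suc t) rewrite sym (nCk+nC[k+1]≡[n+1]C[k+1] (t + suc s) s) =
    +-mono-≤ (positive s t) (1+t≤[t+1+s]C[1+s] s t)
    where
    positive : ∀ s t → 1 ≤ (t + suc s) C s
    positive zero t = ≤-refl
    positive (suc s) t rewrite +-suc t (suc s) | sym (nCk+nC[k+1]≡[n+1]C[k+1] (t + suc s) s) =
      ≤-trans (positive s t) (m≤m+n _ _)

  -- A union bound: of the `suc s`-subsets of `suc (M + b)` points, each of `suc b` distinguished
  -- points lies in `(M + b) C s`, and those missing all of them number `M C suc s`.
  C-drop : ∀ M b s → suc (M + b) C suc s ≤ M C suc s + suc b * ((M + b) C s)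
  C-drop M zero s rewrite +-identityʳ M | sym (nCk+nC[k+1]≡[n+1]C[k+1] M s) = ≤-reflexive (lemma (M C s) (M C suc s))
    where
    lemma : ∀ x y → x + y ≡ y + 1 * x
    lemma = solve-∀
  C-drop M (suc b) s = begin
    suc (M + suc b) C suc s                       ≡⟨ nCk+nC[k+1]≡[n+1]C[k+1] (M + suc b) s ⟨
    (M + suc b) C s + (M + suc b) C suc s         ≡⟨ cong (λ z → z C s + z C suc s) (+-suc M b) ⟩
    suc (M + b) C s + suc (M + b) C suc s         ≤⟨ +-monoʳ-≤ (suc (M + b) C s) (C-drop M b s) ⟩
    suc (M + b) C s + (M C suc s + suc b * ((M + b) C s))
      ≤⟨ +-monoʳ-≤ (suc (M + b) C s) (+-monoʳ-≤ (M C suc s) (*-monoʳ-≤ (suc b) (C-monoˡ-suc (M + b) s))) ⟩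
    suc (M + b) C s + (M C suc s + suc b * (suc (M + b) C s)) ≡⟨ lemma (suc (M + b) C s) (M C suc s) b ⟩
    M C suc s + suc (suc b) * (suc (M + b) C s)   ≡⟨ cong (λ z → M C suc s + suc (suc b) * (z C s)) (+-suc M b) ⟨
    M C suc s + suc (suc b) * ((M + suc b) C s)   ∎
    where
    lemma : ∀ x y b → x + (y + suc b * x) ≡ y + suc (suc b) * x
    lemma = solve-∀

  -- Both sides are falling factorials over the same `s!`. Every factor on the left is at most `L`
  -- and every one on the right at least `M ∸ s`, so each quotient is at most `D`.
  C-ratio : ∀ D s L M → L ≤ D * (M ∸ s) → L C s ≤ D ^ s * (M C s)
  C-ratio D zero L M _ = ≤-refl
  C-ratio D (suc s) zero M _ = z≤n
  C-ratio D (suc s) (suc L) zero L≤ rewrite *-zeroʳ D with () ← L≤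
  C-ratio D (suc s) (suc L) (suc M) L≤ = *-cancelʳ-≤ _ _ (suc s) (begin
    (suc L C suc s) * suc s                   ≡⟨ absorption L s ⟩
    suc L * (L C s)                         ≤⟨ *-mono-≤ (≤-trans L≤ (*-monoʳ-≤ D (≤-trans (m∸n≤m M s) (n≤1+n M))))
                                                        (C-ratio D s L M (≤-trans (n≤1+n L) L≤)) ⟩
    D * suc M * (D ^ s * (M C s))           ≡⟨ swap D (suc M) (D ^ s) (M C s) ⟩
    D * D ^ s * (suc M * (M C s))           ≡⟨ cong (D * D ^ s *_) (absorption M s) ⟨
    D * D ^ s * ((suc M C suc s) * suc s)     ≡⟨ *-assoc (D ^ suc s) (suc M C suc s) (suc s) ⟨
    D ^ suc s * (suc M C suc s) * suc s     ∎)
    where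
    swap : ∀ a b c d → a * b * (c * d) ≡ a * c * (b * d)
    swap = solve-∀

-- The chance that random edges through a vertex of `S` all meet `U`.

module HitProbability where

  open import Data.Nat
  open import Data.Nat.Properties
  open import Data.Nat.Combinatorics using (_C_)
  open import Data.Nat.Combinatorics.Base using (_P′_)
  open import Data.Nat.Tactic.RingSolver using (solve-∀)
  open import Data.Product using (∃; _×_; _,_; proj₁; proj₂)
  open import Relation.Binary.PropositionalEquality using (_≡_; refl; sym; trans; cong; cong₂; subst)
  open Arithmetic

  open ≤-Reasoning

  -- Drawing without replacement is no more likely to give only hits than drawing with replacement,
  -- since `(h - k)/(N - k) ≤ h/N`.
  P′-ratio : ∀ {h N} k → h ≤ N → (h P′ k) * N ^ k ≤ h ^ k * (N P′ k)
  P′-ratio zero _ = ≤-refl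
  P′-ratio {h} {N} (suc k) h≤N = begin
    (h ∸ k) * (h P′ k) * (N * N ^ k)     ≡⟨ swap (h ∸ k) (h P′ k) N (N ^ k) ⟩
    (h ∸ k) * N * ((h P′ k) * N ^ k)       ≤⟨ *-mono-≤ shrink (P′-ratio k h≤N) ⟩
    h * (N ∸ k) * (h ^ k * (N P′ k))     ≡⟨ swap h (N ∸ k) (h ^ k) (N P′ k) ⟩
    h * h ^ k * ((N ∸ k) * (N P′ k))     ∎
    where
    swap : ∀ a b c d → a * b * (c * d) ≡ a * c * (b * d)
    swap = solve-∀
    shrink : (h ∸ k) * N ≤ h * (N ∸ k)
    shrink = begin
      (h ∸ k) * N     ≡⟨ *-distribʳ-∸ N h k ⟩
      h * N ∸ k * N   ≤⟨ ∸-monoʳ-≤ (h * N) (*-monoʳ-≤ k h≤N) ⟩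
      h * N ∸ k * h   ≡⟨ cong (h * N ∸_) (*-comm k h) ⟩
      h * N ∸ h * k   ≡⟨ *-distribˡ-∸ h N k ⟨
      h * (N ∸ k)     ∎

  power-gap : ∀ K q → ∃ λ i → K * q ^ i ≤ suc q ^ i
  -- The exponent is `1` and not `0`, so that the power of zero vanishes.
  power-gap K zero = 1 , ≤-trans (≤-reflexive (*-zeroʳ K)) z≤n
  power-gap K q@(suc _) = i , *-cancelˡ-≤ q (begin
    q * (K * q ^ i)        ≤⟨ m≤m+n _ (q * q ^ i) ⟩
    q * (K * q ^ i) + q * q ^ i ≡⟨ lemma q K (q ^ i) ⟩
    q ^ i * (q + i)        ≤⟨ bernoulli q i ⟩
    q * suc q ^ i          ∎)
    where
    -- With this exponent Bernoulli's inequality gives `(1 + 1/q)^i ≥ 1 + K`.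
    i = q * K
    lemma : ∀ q K y → q * (K * y) + q * y ≡ y * (q + q * K)
    lemma = solve-∀

  -- One factor of the linear bound against i factors of the constant bound make the constant as small as desired.
  combine-bounds : ∀ {h N n a K q} i θ → h * n ≤ K * a * N → h * suc q ≤ q * N → K * θ * q ^ i ≤ suc q ^ i →
                   h ^ suc i * (n * θ) ≤ a * N ^ suc i
  combine-bounds {h} {N} {n} {a} {K} {q} i θ linear constant gap =
    *-cancelʳ-≤ _ _ (suc q ^ i) {{m^n≢0 (suc q) i}} (begin
      h * h ^ i * (n * θ) * suc q ^ i          ≡⟨ swap₁ h (h ^ i) n θ (suc q ^ i) ⟩
      h * n * (h ^ i * suc q ^ i) * θ          ≡⟨ cong (λ z → h * n * z * θ) (^-distribʳ-* h (suc q) i) ⟨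
      h * n * (h * suc q) ^ i * θ              ≤⟨ *-monoˡ-≤ θ (*-mono-≤ linear (^-monoˡ-≤ i constant)) ⟩
      K * a * N * (q * N) ^ i * θ              ≡⟨ cong (λ z → K * a * N * z * θ) (^-distribʳ-* q N i) ⟩
      K * a * N * (q ^ i * N ^ i) * θ          ≡⟨ swap₂ K a N (q ^ i) (N ^ i) θ ⟩
      a * (N * N ^ i) * (K * θ * q ^ i)        ≤⟨ *-monoʳ-≤ (a * (N * N ^ i)) gap ⟩
      a * (N * N ^ i) * suc q ^ i              ∎)
    where
    swap₁ : ∀ a b c d e → a * b * (c * d) * e ≡ a * c * (b * e) * d
    swap₁ = solve-∀
    swap₂ : ∀ K a N u v θ → K * a * N * (u * v) * θ ≡ a * (N * v) * (K * θ * u)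
    swap₂ = solve-∀

  -- Here `a = |S|` and `b = |U|`, an edge through `v ∈ S` consists of `v` and `suc s` of the
  -- `M + b` other vertices, `M` of these lie outside `U`, and `h` edges meet `U`.
  module _ (s a b M h : ℕ) (hits : h + M C suc s ≡ (M + b) C suc s) (b≤ra : b ≤ suc (suc s) * a) where

    private
      r L : ℕ
      r = suc (suc s)
      L = M + b

    -- By `C-drop` at most `b` times `(L - 1) C s` edges through `v` meet `U`, and `absorption`
    -- turns this into a fraction of at most `b (s + 1) / L`. The factor `2` pays for `n = suc L` in
    -- place of `L`.
    linear-bound : 1 ≤ L → h * suc L ≤ 2 * (r * suc s) * a * (L C suc s)
    linear-bound 1≤L = begin
      h * suc L                          ≤⟨ *-monoʳ-≤ h (+-monoˡ-≤ L 1≤L) ⟩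
      h * (L + L)                        ≡⟨ *-distribˡ-+ h L L ⟩
      h * L + h * L                      ≤⟨ +-mono-≤ (bound b hits) (bound b hits) ⟩
      b * ((L C suc s) * suc s) + b * ((L C suc s) * suc s)
        ≤⟨ +-mono-≤ (*-monoˡ-≤ ((L C suc s) * suc s) b≤ra) (*-monoˡ-≤ ((L C suc s) * suc s) b≤ra) ⟩
      r * a * ((L C suc s) * suc s) + r * a * ((L C suc s) * suc s) ≡⟨ lemma r a (L C suc s) (suc s) ⟩
      2 * (r * suc s) * a * (L C suc s) ∎
      where
      lemma : ∀ r a N s → r * a * (N * s) + r * a * (N * s) ≡ 2 * (r * s) * a * N
      lemma = solve-∀
      bound : ∀ b → h + M C suc s ≡ (M + b) C suc s → h * (M + b) ≤ b * (((M + b) C suc s) * suc s)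
      bound zero eq rewrite +-identityʳ M | +-cancelʳ-≡ (M C suc s) h 0 eq = z≤n
      bound (suc b) eq rewrite +-suc M b = begin
        h * suc (M + b)                             ≤⟨ *-monoˡ-≤ (suc (M + b)) h≤ ⟩
        suc b * ((M + b) C s) * suc (M + b)         ≡⟨ trans (*-assoc (suc b) ((M + b) C s) (suc (M + b))) (cong (suc b *_) (*-comm ((M + b) C s) (suc (M + b)))) ⟩
        suc b * (suc (M + b) * ((M + b) C s))       ≡⟨ cong (suc b *_) (absorption (M + b) s) ⟨
        suc b * ((suc (M + b) C suc s) * suc s)       ∎
        where
        h≤ : h ≤ suc b * ((M + b) C s)
        h≤ = +-cancelʳ-≤ (M C suc s) h _ (begin
          h + M C suc s                             ≡⟨ eq ⟩
          suc (M + b) C suc s                       ≤⟨ C-drop M b s ⟩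
          M C suc s + suc b * ((M + b) C s)         ≡⟨ +-comm (M C suc s) _ ⟩
          suc b * ((M + b) C s) + M C suc s         ∎)

    -- Since `S` lies outside `U` and `|U| ≤ r |S|`, the complement of `U` holds at least
    -- `n / (r + 1)` vertices, so a random edge avoids `U` with probability at least `1 / suc q`.
    -- The `2` in `suc q` covers the loss from `suc M` to `M ∸ suc s`, and this is where `n` must be
    -- large.
    constant-bound : ∀ {q} → suc q ≡ (2 * suc r) ^ suc s → a + b ≤ suc L → suc r * (2 * r) ≤ suc L →
                     h * suc q ≤ q * (L C suc s)
    constant-bound {q} eq a+b≤ large = +-cancelʳ-≤ (L C suc s) _ _ (begin
      h * suc q + L C suc s             ≤⟨ +-monoʳ-≤ (h * suc q) (C-ratio (2 * suc r) (suc s) L M L≤) ⟩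
      h * suc q + (2 * suc r) ^ suc s * (M C suc s) ≡⟨ cong (λ z → h * suc q + z * (M C suc s)) eq ⟨
      h * suc q + suc q * (M C suc s)   ≡⟨ lemma h q (M C suc s) ⟩
      suc q * (h + M C suc s)           ≡⟨ cong (suc q *_) hits ⟩
      suc q * (L C suc s)               ≡⟨ +-comm (L C suc s) _ ⟩
      q * (L C suc s) + L C suc s       ∎)
      where
      lemma : ∀ h q c → h * suc q + suc q * c ≡ suc q * (h + c)
      lemma = solve-∀
      a≤1+M : a ≤ suc M
      a≤1+M = +-cancelʳ-≤ b a (suc M) a+b≤
      1+L≤ : suc L ≤ suc r * suc M
      1+L≤ = +-monoʳ-≤ (suc M) (≤-trans b≤ra (*-monoʳ-≤ r a≤1+M))
      2r≤1+M : 2 * r ≤ suc M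
      2r≤1+M = *-cancelˡ-≤ (suc r) (≤-trans large 1+L≤)
      s≤M : suc s ≤ M
      s≤M = ≤-pred (≤-trans (m≤m+n r (r + 0)) 2r≤1+M)
      double : suc M ≤ 2 * (M ∸ suc s)
      double with x ← M ∸ suc s | M∸s+s ← m∸n+n≡m s≤M = begin
        suc M                   ≡⟨ cong suc M∸s+s ⟨
        suc (x + suc s)         ≡⟨ +-suc x (suc s) ⟨
        x + r                   ≤⟨ +-monoʳ-≤ x r≤x ⟩
        x + x                   ≡⟨ cong (x +_) (+-identityʳ x) ⟨
        2 * x                   ∎
        where
        r≤x : r ≤ x
        r≤x = +-cancelʳ-≤ r r x (begin
          r + r                 ≡⟨ cong (r +_) (+-identityʳ r) ⟨
          2 * r                 ≤⟨ 2r≤1+M ⟩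
          suc M                 ≡⟨ cong suc M∸s+s ⟨
          suc (x + suc s)       ≡⟨ +-suc x (suc s) ⟨
          x + r                 ∎)
      L≤ : L ≤ 2 * suc r * (M ∸ suc s)
      L≤ = begin
        L                             ≤⟨ n≤1+n L ⟩
        suc L                         ≤⟨ 1+L≤ ⟩
        suc r * suc M                 ≤⟨ *-monoʳ-≤ (suc r) double ⟩
        suc r * (2 * (M ∸ suc s))     ≡⟨ *-assoc (suc r) 2 (M ∸ suc s) ⟨
        suc r * 2 * (M ∸ suc s)       ≡⟨ cong (_* (M ∸ suc s)) (*-comm (suc r) 2) ⟩
        2 * suc r * (M ∸ suc s)       ∎

  -- h counts the edges of the complete (s+1)-graph on L + 1 vertices through a fixed vertex that meet a given set
  -- of b other vertices, so that h / (L C s) is the chance that a random edge through the vertex meets that set.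
  HitBound : (s k L : ℕ) → Set
  HitBound s k L = ∀ a b M h → M + b ≡ L → h + M C s ≡ L C s → b ≤ suc s * a → a + b ≤ suc L →
    h ^ k * (suc L ^ (4 + s) * 256) ≤ a ^ (4 + s) * (L C s) ^ k

  -- The `k = suc i * j` edges are treated as `j` blocks. By `combine-bounds` the factor for one
  -- block is at most `a / (256 n)`, and `j = r + 3` blocks give the required exponent.
  hit-bound : ∀ s → ∃ λ k → 1 ≤ k × ∃ λ N → ∀ L → N ≤ L → k ≤ L C s × HitBound s k L
  -- For `r = 1` the only edge through `v` is the singleton of `v`, which misses `U`; hence `h` is
  -- `0`.
  hit-bound zero = 1 , ≤-refl , 0 , λ L _ → ≤-refl , λ a b M h _ eq _ _ →
    subst (λ h → h ^ 1 * (suc L ^ 4 * 256) ≤ a ^ 4 * 1) (sym (+-cancelʳ-≡ 1 h 0 eq)) z≤n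
  hit-bound (suc s) = suc i * j , s≤s z≤n , N , λ L N≤L → k≤ L N≤L , hit L N≤L
    where
    r = suc (suc s)
    j = 5 + s
    K = 2 * (r * suc s)
    q = pred ((2 * suc r) ^ suc s)
    1+q≡ : suc q ≡ (2 * suc r) ^ suc s
    1+q≡ = suc-pred ((2 * suc r) ^ suc s) {{m^n≢0 (2 * suc r) (suc s)}}
    gap = power-gap (K * 256) q
    i = proj₁ gap
    -- The first two summands ensure `k ≤ L C suc s`, the last one the largeness asked for in
    -- `constant-bound`.
    N = suc i * j + suc s + suc r * (2 * r)
    k≤ : ∀ L → N ≤ L → suc i * j ≤ L C suc s
    k≤ L N≤L = begin
      suc i * j                        ≤⟨ m+n≤o⇒m≤o∸n _ k+s≤L ⟩
      L ∸ suc s                        ≤⟨ n≤1+n _ ⟩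
      suc (L ∸ suc s)                  ≤⟨ 1+t≤[t+1+s]C[1+s] s (L ∸ suc s) ⟩
      (L ∸ suc s + suc s) C suc s      ≡⟨ cong (_C suc s) (m∸n+n≡m (≤-trans (m≤n+m (suc s) (suc i * j)) k+s≤L)) ⟩
      L C suc s                        ∎
      where
      k+s≤L : suc i * j + suc s ≤ L
      k+s≤L = ≤-trans (m≤m+n _ _) N≤L
    hit : ∀ L → N ≤ L → HitBound (suc s) (suc i * j) L
    hit .(M + b) N≤L a b M h refl hits b≤ra a+b≤ = begin
      h ^ (suc i * j) * (suc L ^ j * 256)       ≤⟨ *-monoʳ-≤ (h ^ (suc i * j)) (*-monoʳ-≤ (suc L ^ j) (^-monoʳ-≤ 256 {1} {j} (s≤s z≤n))) ⟩
      h ^ (suc i * j) * (suc L ^ j * 256 ^ j)   ≡⟨ cong₂ _*_ (^-*-assoc h (suc i) j) (^-distribʳ-* (suc L) 256 j) ⟨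
      (h ^ suc i) ^ j * (suc L * 256) ^ j       ≡⟨ ^-distribʳ-* (h ^ suc i) (suc L * 256) j ⟨
      (h ^ suc i * (suc L * 256)) ^ j           ≤⟨ ^-monoˡ-≤ j bound ⟩
      (a * (L C suc s) ^ suc i) ^ j             ≡⟨ ^-distribʳ-* a ((L C suc s) ^ suc i) j ⟩
      a ^ j * ((L C suc s) ^ suc i) ^ j         ≡⟨ cong (a ^ j *_) (^-*-assoc (L C suc s) (suc i) j) ⟩
      a ^ j * (L C suc s) ^ (suc i * j)         ∎
      where
      L = M + b
      bound : h ^ suc i * (suc L * 256) ≤ a * (L C suc s) ^ suc i
      bound = combine-bounds {h} {L C suc s} {suc L} {a} {K} {q} i 256
        (linear-bound s a b M h hits b≤ra (≤-trans (s≤s z≤n) N≤L))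
        (constant-bound s a b M h hits b≤ra 1+q≡ a+b≤ (≤-trans (m≤n+m _ (suc i * j + suc s)) (≤-trans N≤L (n≤1+n L))))
        (proj₂ gap)

-- Finite sums, duplicate-free words and products of independent choices.

module Counting where

  open import Algebra.Bundles using (CommutativeSemiring)
  open import Data.Bool using (Bool; true; false; not; _∧_; _∨_; T)
  open import Data.Bool.ListAction using (all; any)
  open import Data.Bool.Properties using (∧-assoc; ∧-identityʳ)
  open import Data.Fin using (Fin; zero; suc)
  open import Data.Fin.Subset using (Subset; ∣_∣) renaming (_∈_ to _∈ˢ_)
  open import Data.List using (List; []; _∷_; _++_; map; length; filter; cartesianProductWith)
  open import Data.List.Membership.Propositional using (_∈_)
  open import Data.List.Membership.Propositional.Properties using (∈-cartesianProductWith⁺; ∈-cartesianProductWith⁻)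
  open import Data.List.Relation.Unary.All as All using (All; []; _∷_)
  open import Data.List.Relation.Unary.AllPairs using ([]; _∷_)
  open import Data.List.Relation.Unary.Any using (here; there)
  open import Data.List.Relation.Unary.Unique.Propositional using (Unique)
  open import Data.List.Relation.Unary.Unique.Propositional.Properties using (cartesianProductWith⁺)
  import Data.List.Relation.Unary.Unique.DecPropositional as DecUnique
  open import Data.Nat hiding (_≟_)
  open import Data.Nat.Properties hiding (_≟_)
  open import Data.Nat.Combinatorics.Base using (_P′_)
  open import Data.Nat.Tactic.RingSolver using (solve-∀)
  open import Data.Product using (_×_; _,_; proj₁; proj₂)
  open import Data.Vec as Vec using (Vec; []; _∷_; lookup)
  open import Data.Vec.Properties using (∷-injective)
  import Data.List.Properties as List
  open import Data.List.Relation.Unary.All.Properties using (all⁺)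
  open import Function using (_∘_)
  open import Level using (0ℓ)
  open import Relation.Binary using (DecidableEquality)
  open import Relation.Binary.PropositionalEquality as ≡ using (_≡_; _≢_; cong; cong₂)
  open import Relation.Nullary using (does; yes; no; ¬?; contradiction)
  open import Relation.Unary using (Decidable)

  private variable
    A B D : Set

  -- Stated over a commutative semiring because outcomes are counted in the naturals while vertex
  -- weights are integers.
  module ListSum (R : CommutativeSemiring 0ℓ 0ℓ) where
    private module R = CommutativeSemiring R
    open R using (Carrier; _≈_; 0#) renaming (_+_ to _⊕_; _*_ to _⊗_)
    open import Algebra.Properties.CommutativeSemigroup R.+-commutativeSemigroup using (interchange)
    open import Relation.Binary.Reasoning.Setoid R.setoid

    ∑ : List A → (A → Carrier) → Carrier
    ∑ [] f = 0#
    ∑ (x ∷ xs) f = f x ⊕ ∑ xs f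

    ∑-cong : ∀ (xs : List A) {f g : A → Carrier} → (∀ {x} → x ∈ xs → f x ≈ g x) → ∑ xs f ≈ ∑ xs g
    ∑-cong [] _ = R.refl
    ∑-cong (x ∷ xs) f≈g = R.+-cong (f≈g (here ≡.refl)) (∑-cong xs (f≈g ∘ there))

    ∑-zero : ∀ (xs : List A) → ∑ xs (λ _ → 0#) ≈ 0#
    ∑-zero [] = R.refl
    ∑-zero (x ∷ xs) = R.trans (R.+-identityˡ _) (∑-zero xs)

    ∑-+ : ∀ (xs : List A) (f g : A → Carrier) → ∑ xs (λ x → f x ⊕ g x) ≈ ∑ xs f ⊕ ∑ xs g
    ∑-+ [] f g = R.sym (R.+-identityˡ 0#)
    ∑-+ (x ∷ xs) f g = R.trans (R.+-congˡ (∑-+ xs f g)) (interchange _ _ _ _)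

    ∑-*ˡ : ∀ (xs : List A) c (f : A → Carrier) → ∑ xs (λ x → c ⊗ f x) ≈ c ⊗ ∑ xs f
    ∑-*ˡ [] c f = R.sym (R.zeroʳ c)
    ∑-*ˡ (x ∷ xs) c f = R.trans (R.+-congˡ (∑-*ˡ xs c f)) (R.sym (R.distribˡ c _ _))

    ∑-swap : ∀ (xs : List A) (ys : List B) (f : A → B → Carrier) →
             ∑ xs (λ x → ∑ ys (f x)) ≈ ∑ ys (λ y → ∑ xs (λ x → f x y))
    ∑-swap [] ys f = R.sym (∑-zero ys)
    ∑-swap (x ∷ xs) ys f = R.trans (R.+-congˡ (∑-swap xs ys f)) (R.sym (∑-+ ys (f x) _))

    ∑-++ : ∀ (xs ys : List A) (f : A → Carrier) → ∑ (xs ++ ys) f ≈ ∑ xs f ⊕ ∑ ys f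
    ∑-++ [] ys f = R.sym (R.+-identityˡ _)
    ∑-++ (x ∷ xs) ys f = R.trans (R.+-congˡ (∑-++ xs ys f)) (R.sym (R.+-assoc _ _ _))

    ∑-map : ∀ (g : A → B) (xs : List A) (f : B → Carrier) → ∑ (map g xs) f ≡ ∑ xs (f ∘ g)
    ∑-map g [] f = ≡.refl
    ∑-map g (x ∷ xs) f = cong (f (g x) ⊕_) (∑-map g xs f)

    ∑-cartesianProductWith : ∀ (g : A → B → D) (xs : List A) (ys : List B) (f : D → Carrier) →
                             ∑ (cartesianProductWith g xs ys) f ≈ ∑ xs (λ x → ∑ ys (λ y → f (g x y)))
    ∑-cartesianProductWith g [] ys f = R.refl
    ∑-cartesianProductWith g (x ∷ xs) ys f = begin
      ∑ (map (g x) ys ++ cartesianProductWith g xs ys) f       ≈⟨ ∑-++ (map (g x) ys) _ f ⟩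
      ∑ (map (g x) ys) f ⊕ ∑ (cartesianProductWith g xs ys) f  ≈⟨ R.+-cong (R.reflexive (∑-map (g x) ys f))
                                                                           (∑-cartesianProductWith g xs ys f) ⟩
      ∑ ys (f ∘ g x) ⊕ ∑ xs (λ x → ∑ ys (λ y → f (g x y)))     ∎

  open ListSum +-*-commutativeSemiring public

  open ≡ using (refl; sym; trans; subst)
  open ≤-Reasoning

  ∑-mono : ∀ (xs : List A) {f g : A → ℕ} → (∀ {x} → x ∈ xs → f x ≤ g x) → ∑ xs f ≤ ∑ xs g
  ∑-mono [] _ = z≤n
  ∑-mono (x ∷ xs) f≤g = +-mono-≤ (f≤g (here refl)) (∑-mono xs (f≤g ∘ there))

  ∑-const : ∀ (xs : List A) c → ∑ xs (λ _ → c) ≡ length xs * c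
  ∑-const [] c = refl
  ∑-const (x ∷ xs) c = cong (c +_) (∑-const xs c)

  𝟙 : Bool → ℕ
  𝟙 true = 1
  𝟙 false = 0

  𝟙-∧ : ∀ a b → 𝟙 (a ∧ b) ≡ 𝟙 a * 𝟙 b
  𝟙-∧ false b = refl
  𝟙-∧ true b = sym (+-identityʳ (𝟙 b))

  count : (A → Bool) → List A → ℕ
  count p xs = ∑ xs (𝟙 ∘ p)

  count-cong : ∀ {p q : A → Bool} (xs : List A) → (∀ x → p x ≡ q x) → count p xs ≡ count q xs
  count-cong xs p≡q = ∑-cong xs (λ {x} _ → cong 𝟙 (p≡q x))

  count-true : ∀ (xs : List A) → count (λ _ → true) xs ≡ length xs
  count-true [] = refl
  count-true (x ∷ xs) = cong suc (count-true xs)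

  count-not : ∀ (p : A → Bool) xs → count (not ∘ p) xs + count p xs ≡ length xs
  count-not p xs = trans (sym (∑-+ xs _ _)) (trans (∑-cong xs (λ {x} _ → split (p x))) (count-true xs))
    where
    split : ∀ b → 𝟙 (not b) + 𝟙 b ≡ 1
    split true = refl
    split false = refl

  length-filter≡count : ∀ {P : A → Set} (P? : Decidable P) xs → length (filter P? xs) ≡ count (does ∘ P?) xs
  length-filter≡count P? [] = refl
  length-filter≡count P? (x ∷ xs) with does (P? x)
  ... | true = cong suc (length-filter≡count P? xs)
  ... | false = length-filter≡count P? xs

  count-any : ∀ (q : B → A → Bool) (ys : List B) xs → count (λ x → any (λ y → q y x) ys) xs ≤ ∑ ys (λ y → count (q y) xs)
  count-any q ys xs = begin
    count (λ x → any (λ y → q y x) ys) xs        ≤⟨ ∑-mono xs (λ {x} _ → union ys x) ⟩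
    ∑ xs (λ x → ∑ ys (λ y → 𝟙 (q y x)))          ≡⟨ ∑-swap xs ys _ ⟩
    ∑ ys (λ y → count (q y) xs)                  ∎
    where
    union : ∀ ys x → 𝟙 (any (λ y → q y x) ys) ≤ ∑ ys (λ y → 𝟙 (q y x))
    union [] x = z≤n
    union (y ∷ ys) x with q y x
    ... | true = s≤s z≤n
    ... | false = union ys x

  count-product : ∀ (f : A → B → D) {p : A → Bool} {q : B → Bool} {h : D → Bool} xs ys →
                  (∀ x y → h (f x y) ≡ p x ∧ q y) →
                  count h (cartesianProductWith f xs ys) ≡ count p xs * count q ys
  count-product f {p} {q} {h} xs ys h≡ = begin-equality
    count h (cartesianProductWith f xs ys)        ≡⟨ ∑-cartesianProductWith f xs ys _ ⟩
    ∑ xs (λ x → ∑ ys (λ y → 𝟙 (h (f x y))))       ≡⟨ ∑-cong xs (λ {x} _ → ∑-cong ys (λ {y} _ → trans (cong 𝟙 (h≡ x y)) (𝟙-∧ (p x) (q y)))) ⟩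
    ∑ xs (λ x → ∑ ys (λ y → 𝟙 (p x) * 𝟙 (q y)))   ≡⟨ ∑-cong xs (λ {x} _ → trans (∑-*ˡ ys (𝟙 (p x)) _) (*-comm (𝟙 (p x)) _)) ⟩
    ∑ xs (λ x → count q ys * 𝟙 (p x))             ≡⟨ ∑-*ˡ xs (count q ys) _ ⟩
    count q ys * count p xs                       ≡⟨ *-comm (count q ys) _ ⟩
    count p xs * count q ys                       ∎

  length-product : ∀ (f : A → B → D) xs ys → length (cartesianProductWith f xs ys) ≡ length xs * length ys
  length-product f xs ys = begin-equality
    length (cartesianProductWith f xs ys)                 ≡⟨ count-true (cartesianProductWith f xs ys) ⟨
    count (λ _ → true) (cartesianProductWith f xs ys)     ≡⟨ count-product f xs ys (λ _ _ → refl) ⟩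
    count (λ _ → true) xs * count (λ _ → true) ys         ≡⟨ cong₂ _*_ (count-true xs) (count-true ys) ⟩
    length xs * length ys                                 ∎

  words : ℕ → List A → List (List A)
  words zero xs = [] ∷ []
  words (suc k) xs = cartesianProductWith _∷_ xs (words k xs)

  module _ {xs : List A} where

    words-unique : ∀ k → Unique xs → Unique (words k xs)
    words-unique zero xs! = [] ∷ []
    words-unique (suc k) xs! = cartesianProductWith⁺ _∷_ List.∷-injective xs! (words-unique k xs!)

    ∈-words⁺ : ∀ {L} → All (_∈ xs) L → L ∈ words (length L) xs
    ∈-words⁺ [] = here refl
    ∈-words⁺ (x∈ ∷ L⊆) = ∈-cartesianProductWith⁺ _∷_ x∈ (∈-words⁺ L⊆)

    ∈-words⁻ : ∀ k {L} → L ∈ words k xs → length L ≡ k × All (_∈ xs) L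
    ∈-words⁻ zero (here refl) = refl , []
    ∈-words⁻ (suc k) L∈ with _ , _ , x∈ , L′∈ , refl ← ∈-cartesianProductWith⁻ _∷_ xs (words k xs) L∈ =
      cong suc (proj₁ (∈-words⁻ k L′∈)) , x∈ ∷ proj₂ (∈-words⁻ k L′∈)

  module Distinct (_≟_ : DecidableEquality A) where
    open DecUnique _≟_ using (unique?)

    fresh : A → List A → Bool
    fresh x L = does (All.all? (λ y → ¬? (x ≟ y)) L)

    distinct : List A → Bool
    distinct L = does (unique? L)

    count-remove : ∀ (p : A → Bool) {xs y} → Unique xs → y ∈ xs → T (p y) →
                   suc (count (λ x → p x ∧ not (does (x ≟ y))) xs) ≡ count p xs
    count-remove p {x ∷ xs} {y} (x∉ ∷ xs!) (here refl) py with x ≟ x | p x in px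
    ... | yes _ | true = cong suc (∑-cong xs keep)
      where
      keep : ∀ {z} → z ∈ xs → 𝟙 (p z ∧ not (does (z ≟ x))) ≡ 𝟙 (p z)
      keep {z} z∈ with z ≟ x
      ... | yes refl = contradiction refl (All.lookup x∉ z∈)
      ... | no _ = cong 𝟙 (∧-identityʳ (p z))
    ... | no x≢x | true = contradiction refl x≢x
    count-remove p {x ∷ xs} {y} (x∉ ∷ xs!) (there y∈) py with x ≟ y
    ... | yes refl = contradiction refl (All.lookup x∉ y∈)
    ... | no _ = begin-equality
      suc (𝟙 (p x ∧ true) + count (λ x → p x ∧ not (does (x ≟ y))) xs)
        ≡⟨ cong (λ b → suc (𝟙 b + count (λ x → p x ∧ not (does (x ≟ y))) xs)) (∧-identityʳ (p x)) ⟩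
      suc (𝟙 (p x) + count (λ x → p x ∧ not (does (x ≟ y))) xs)
        ≡⟨ +-suc (𝟙 (p x)) _ ⟨
      𝟙 (p x) + suc (count (λ x → p x ∧ not (does (x ≟ y))) xs)
        ≡⟨ cong (𝟙 (p x) +_) (count-remove p xs! y∈ py) ⟩
      𝟙 (p x) + count p xs ∎

    -- Each letter of `L` removes exactly one candidate. The predicate is strengthened along the
    -- induction to exclude the letters already removed, so the later ones are counted among what
    -- remains.
    count-fresh : ∀ (p : A → Bool) {xs} → Unique xs → ∀ {L} → Unique L → All (_∈ xs) L → All (T ∘ p) L →
                  count (λ x → p x ∧ fresh x L) xs + length L ≡ count p xs
    count-fresh p {xs} xs! {[]} L! L⊆ pL = trans (+-identityʳ _) (count-cong xs (λ x → ∧-identityʳ (p x)))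
    count-fresh p {xs} xs! {y ∷ L} (y∉ ∷ L!) (y∈ ∷ L⊆) (py ∷ pL) = begin-equality
      count (λ x → p x ∧ (not (does (x ≟ y)) ∧ fresh x L)) xs + suc (length L)
        ≡⟨ +-suc _ (length L) ⟩
      suc (count (λ x → p x ∧ (not (does (x ≟ y)) ∧ fresh x L)) xs + length L)
        ≡⟨ cong (λ c → suc (c + length L)) (count-cong xs (λ x → sym (∧-assoc (p x) (not (does (x ≟ y))) (fresh x L)))) ⟩
      suc (count (λ x → (p x ∧ not (does (x ≟ y))) ∧ fresh x L) xs + length L)
        ≡⟨ cong suc (count-fresh (λ x → p x ∧ not (does (x ≟ y))) xs! L! L⊆ (All.zipWith survives (y∉ , pL))) ⟩
      suc (count (λ x → p x ∧ not (does (x ≟ y))) xs)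
        ≡⟨ count-remove p xs! y∈ py ⟩
      count p xs ∎
      where
      survives : ∀ {z} → y ≢ z × T (p z) → T (p z ∧ not (does (z ≟ y)))
      survives {z} (y≢z , pz) with z ≟ y
      ... | yes refl = contradiction refl y≢z
      ... | no _ = subst T (sym (∧-identityʳ (p z))) pz

    length-⊆ : ∀ {xs L} → Unique xs → Unique L → All (_∈ xs) L → length L ≤ length xs
    length-⊆ {xs} {L} xs! L! L⊆ = begin
      length L                               ≤⟨ m≤n+m (length L) _ ⟩
      count (λ x → fresh x L) xs + length L  ≡⟨ count-fresh (λ _ → true) xs! L! L⊆ (All.universal (λ _ → _) L) ⟩
      count (λ _ → true) xs                  ≡⟨ count-true xs ⟩
      length xs                              ∎

    -- Exchanging the sums fixes the tail first. A distinct tail of `k` letters satisfying `p` uses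
    -- up `k` of the `count p xs` candidates, so `count p xs ∸ k` first letters remain, which is the
    -- recursion of `_P′_`.
    count-words : ∀ (p : A → Bool) {xs} → Unique xs → ∀ k →
                  count (λ L → distinct L ∧ all p L) (words k xs) ≡ count p xs P′ k
    count-words p xs! zero = refl
    count-words p {xs} xs! (suc k) = begin-equality
      count (λ L → distinct L ∧ all p L) (words (suc k) xs)
        ≡⟨ ∑-cartesianProductWith _∷_ xs (words k xs) _ ⟩
      ∑ xs (λ x → ∑ (words k xs) (λ L → 𝟙 ((fresh x L ∧ distinct L) ∧ (p x ∧ all p L))))
        ≡⟨ ∑-swap xs (words k xs) _ ⟩
      ∑ (words k xs) (λ L → count (λ x → (fresh x L ∧ distinct L) ∧ (p x ∧ all p L)) xs)
        ≡⟨ ∑-cong (words k xs) extend ⟩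
      ∑ (words k xs) (λ L → (count p xs ∸ k) * 𝟙 (distinct L ∧ all p L))
        ≡⟨ ∑-*ˡ (words k xs) (count p xs ∸ k) _ ⟩
      (count p xs ∸ k) * count (λ L → distinct L ∧ all p L) (words k xs)
        ≡⟨ cong ((count p xs ∸ k) *_) (count-words p xs! k) ⟩
      (count p xs ∸ k) * (count p xs P′ k) ∎
      where
      shuffle : ∀ a b c d → (a ∧ b) ∧ (c ∧ d) ≡ (b ∧ d) ∧ (c ∧ a)
      shuffle false false c d = refl
      shuffle false true c false = refl
      shuffle false true false true = refl
      shuffle false true true true = refl
      shuffle true false c d = refl
      shuffle true true false false = refl
      shuffle true true false true = refl
      shuffle true true true false = refl
      shuffle true true true true = refl
      extend : ∀ {L} → L ∈ words k xs →
               count (λ x → (fresh x L ∧ distinct L) ∧ (p x ∧ all p L)) xs ≡ (count p xs ∸ k) * 𝟙 (distinct L ∧ all p L)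
      extend {L} L∈ with refl , L⊆ ← ∈-words⁻ k L∈ = begin-equality
        count (λ x → (fresh x L ∧ distinct L) ∧ (p x ∧ all p L)) xs
          ≡⟨ ∑-cong xs (λ {x} _ → trans (cong 𝟙 (shuffle (fresh x L) (distinct L) (p x) (all p L))) (𝟙-∧ (distinct L ∧ all p L) _)) ⟩
        ∑ xs (λ x → 𝟙 (distinct L ∧ all p L) * 𝟙 (p x ∧ fresh x L))
          ≡⟨ ∑-*ˡ xs (𝟙 (distinct L ∧ all p L)) _ ⟩
        𝟙 (distinct L ∧ all p L) * count (λ x → p x ∧ fresh x L) xs
          ≡⟨ fresh-count ⟩
        𝟙 (distinct L ∧ all p L) * (count p xs ∸ length L)
          ≡⟨ *-comm (𝟙 (distinct L ∧ all p L)) _ ⟩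
        (count p xs ∸ length L) * 𝟙 (distinct L ∧ all p L) ∎
        where
        -- The indicator of the tail acts as a guard: the number of fresh letters is known only when
        -- the tail passes both tests, and otherwise both sides vanish.
        fresh-count : 𝟙 (distinct L ∧ all p L) * count (λ x → p x ∧ fresh x L) xs ≡
                      𝟙 (distinct L ∧ all p L) * (count p xs ∸ length L)
        fresh-count with unique? L | all p L in pL
        ... | no _ | _ = refl
        ... | yes _ | false = refl
        ... | yes L! | true = cong (1 *_) (trans (sym (m+n∸n≡m _ (length L)))
                (cong (_∸ length L) (count-fresh p xs! L! L⊆ (all⁺ p L (subst T (sym pL) _)))))

  tuples : ∀ {n} → Vec (List A) n → List (Vec A n)
  tuples [] = [] ∷ []
  tuples (xs ∷ xss) = cartesianProductWith _∷_ xs (tuples xss)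

  tuples-unique : ∀ {n} (xss : Vec (List A) n) → (∀ i → Unique (lookup xss i)) → Unique (tuples xss)
  tuples-unique [] _ = [] ∷ []
  tuples-unique (xs ∷ xss) xss! = cartesianProductWith⁺ _∷_ ∷-injective (xss! zero) (tuples-unique xss (xss! ∘ suc))

  ∈-tuples⁺ : ∀ {n} (xss : Vec (List A) n) {ω} → (∀ i → lookup ω i ∈ lookup xss i) → ω ∈ tuples xss
  ∈-tuples⁺ [] {[]} _ = here refl
  ∈-tuples⁺ (xs ∷ xss) {x ∷ ω} ω∈ = ∈-cartesianProductWith⁺ _∷_ (ω∈ zero) (∈-tuples⁺ xss (ω∈ ∘ suc))

  ∈-tuples⁻ : ∀ {n} (xss : Vec (List A) n) {ω} → ω ∈ tuples xss → ∀ i → lookup ω i ∈ lookup xss i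
  ∈-tuples⁻ (xs ∷ xss) ω∈ i with _ , _ , x∈ , ω′∈ , refl ← ∈-cartesianProductWith⁻ _∷_ xs (tuples xss) ω∈ with i
  ... | zero = x∈
  ... | suc i = ∈-tuples⁻ xss ω′∈ i

  allOn : ∀ {n} → (A → Bool) → Subset n → Vec A n → Bool
  allOn q [] [] = true
  allOn q (b ∷ S) (x ∷ ω) = (not b ∨ q x) ∧ allOn q S ω

  -- Independence: the fractions `G / F` at the coordinates in `S` multiply, and each coordinate
  -- outside `S` contributes its full list to both sides.
  count-allOn : ∀ {n} (q : A → Bool) (S : Subset n) (xss : Vec (List A) n) F G →
                (∀ i → i ∈ˢ S → count q (lookup xss i) * F ≤ G * length (lookup xss i)) →
                count (allOn q S) (tuples xss) * F ^ ∣ S ∣ ≤ G ^ ∣ S ∣ * length (tuples xss)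
  count-allOn q [] [] F G _ = ≤-refl
  count-allOn q (true ∷ S) (xs ∷ xss) F G bound
    rewrite count-product Vec._∷_ {q = allOn q S} {h = allOn q (true ∷ S)} xs (tuples xss) (λ _ _ → refl)
          | length-product {D = Vec _ _} Vec._∷_ xs (tuples xss)
    = begin
    count q xs * count (allOn q S) (tuples xss) * (F * F ^ ∣ S ∣)
      ≡⟨ swap (count q xs) _ F _ ⟩
    count q xs * F * (count (allOn q S) (tuples xss) * F ^ ∣ S ∣)
      ≤⟨ *-mono-≤ (bound zero Vec.here) (count-allOn q S xss F G (λ i i∈ → bound (suc i) (Vec.there i∈))) ⟩
    G * length xs * (G ^ ∣ S ∣ * length (tuples xss))
      ≡⟨ swap G (length xs) _ _ ⟩
    G * G ^ ∣ S ∣ * (length xs * length (tuples xss)) ∎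
    where
    swap : ∀ a b c d → a * b * (c * d) ≡ a * c * (b * d)
    swap = solve-∀
  count-allOn q (false ∷ S) (xs ∷ xss) F G bound
    rewrite count-product Vec._∷_ {q = allOn q S} {h = allOn q (false ∷ S)} xs (tuples xss) (λ _ _ → refl)
          | length-product {D = Vec _ _} Vec._∷_ xs (tuples xss)
    = begin
    count (λ _ → true) xs * count (allOn q S) (tuples xss) * F ^ ∣ S ∣
      ≡⟨ cong (λ c → c * count (allOn q S) (tuples xss) * F ^ ∣ S ∣) (count-true xs) ⟩
    length xs * count (allOn q S) (tuples xss) * F ^ ∣ S ∣
      ≡⟨ *-assoc (length xs) _ _ ⟩
    length xs * (count (allOn q S) (tuples xss) * F ^ ∣ S ∣)
      ≤⟨ *-monoʳ-≤ (length xs) (count-allOn q S xss F G (λ i i∈ → bound (suc i) (Vec.there i∈))) ⟩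
    length xs * (G ^ ∣ S ∣ * length (tuples xss))
      ≡⟨ swap (length xs) (G ^ ∣ S ∣) (length (tuples xss)) ⟩
    G ^ ∣ S ∣ * (length xs * length (tuples xss)) ∎
    where
    swap : ∀ a b c → a * (b * c) ≡ b * (a * c)
    swap = solve-∀

-- Enumeration of vertex sets and of the edges through a vertex.

module Enumeration where

  open import Data.Bool using (Bool; true; false; not; _∧_; T)
  open import Data.Fin using (Fin; zero; suc)
  open import Data.Fin.Subset using (Subset; ∣_∣; _∈_; _∉_; ∁; ⊥)
  open import Data.Fin.Subset.Properties using (∣∁p∣≡n∸∣p∣; ∣⊥∣≡0; ∉⊥; ∣p∣≤n)
  open import Data.List using (List; []; _∷_; _++_; map; length)
  open import Data.List.Membership.Propositional using () renaming (_∈_ to _∈ₗ_)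
  open import Data.List.Membership.Propositional.Properties using (∈-map⁺; ∈-map⁻; ∈-++⁺ˡ; ∈-++⁺ʳ; ∈-++⁻)
  open import Data.List.Properties using (length-map; length-++)
  open import Data.List.Relation.Binary.Disjoint.Propositional using (Disjoint)
  open import Data.List.Relation.Unary.AllPairs using ([]; _∷_)
  open import Data.List.Relation.Unary.All using ([]; _∷_)
  open import Data.List.Relation.Unary.Any using (here; there)
  open import Data.List.Relation.Unary.Unique.Propositional using (Unique)
  open import Data.List.Relation.Unary.Unique.Propositional.Properties using (map⁺; ++⁺)
  open import Data.Nat hiding (_≟_)
  open import Data.Nat.Properties hiding (_≟_)
  open import Data.Nat.Combinatorics using (_C_; nCk+nC[k+1]≡[n+1]C[k+1])
  open import Data.Nat.Tactic.RingSolver using (solve-∀)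
  open import Data.Product using (_×_; _,_; proj₁; proj₂)
  open import Data.Sum using (inj₁; inj₂)
  open import Data.Vec using ([]; _∷_; here; there)
  open import Data.Vec.Properties using (∷-injectiveʳ)
  open import Function using (_∘_)
  open import Relation.Binary.PropositionalEquality using (_≡_; refl; sym; trans; cong; cong₂; subst)
  open import Relation.Nullary using (contradiction)
  open Arithmetic
  open Counting

  open ≤-Reasoning

  -- A recursive Boolean test, so that it computes when the enumerations below prefix a coordinate.
  disjoint : ∀ {n} → Subset n → Subset n → Bool
  disjoint [] [] = true
  disjoint (x ∷ e) (y ∷ S) = not (x ∧ y) ∧ disjoint e S

  hits : ∀ {n} → Subset n → Subset n → Bool
  hits S e = not (disjoint e S)

  disjoint-∉ : ∀ {n} (e S : Subset n) → T (disjoint e S) → ∀ {v} → v ∈ e → v ∉ S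
  disjoint-∉ (true ∷ e) (true ∷ S) () here here
  disjoint-∉ (false ∷ e) (_ ∷ S) d (there v∈e) (there v∈S) = disjoint-∉ e S d v∈e v∈S
  disjoint-∉ (true ∷ e) (false ∷ S) d (there v∈e) (there v∈S) = disjoint-∉ e S d v∈e v∈S

  ∉-disjoint : ∀ {n} (e S : Subset n) → (∀ {v} → v ∈ e → v ∉ S) → T (disjoint e S)
  ∉-disjoint [] [] _ = _
  ∉-disjoint (true ∷ e) (true ∷ S) d = contradiction here (d here)
  ∉-disjoint (true ∷ e) (false ∷ S) d = ∉-disjoint e S (λ v∈e → d (there v∈e) ∘ there)
  ∉-disjoint (false ∷ e) (_ ∷ S) d = ∉-disjoint e S (λ v∈e → d (there v∈e) ∘ there)

  disjoint-⊥ : ∀ {n} (e : Subset n) → disjoint e ⊥ ≡ true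
  disjoint-⊥ [] = refl
  disjoint-⊥ (true ∷ e) = disjoint-⊥ e
  disjoint-⊥ (false ∷ e) = disjoint-⊥ e

  disjoint-size : ∀ {n} (e S : Subset n) → T (disjoint e S) → ∣ e ∣ + ∣ S ∣ ≤ n
  disjoint-size [] [] _ = z≤n
  disjoint-size (true ∷ e) (false ∷ S) d = s≤s (disjoint-size e S d)
  disjoint-size (false ∷ e) (true ∷ S) d rewrite +-suc ∣ e ∣ ∣ S ∣ = s≤s (disjoint-size e S d)
  disjoint-size (false ∷ e) (false ∷ S) d = ≤-trans (disjoint-size e S d) (n≤1+n _)

  atMost : ∀ n → ℕ → List (Subset n)
  atMost zero c = [] ∷ []
  atMost (suc n) zero = map (false ∷_) (atMost n zero)
  atMost (suc n) (suc c) = map (false ∷_) (atMost n (suc c)) ++ map (true ∷_) (atMost n c)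

  ∈-atMost : ∀ {n} (S : Subset n) {c} → ∣ S ∣ ≤ c → S ∈ₗ atMost n c
  ∈-atMost [] _ = here refl
  ∈-atMost (false ∷ S) {zero} S≤ = ∈-map⁺ _ (∈-atMost S S≤)
  ∈-atMost (false ∷ S) {suc c} S≤ = ∈-++⁺ˡ (∈-map⁺ _ (∈-atMost S S≤))
  ∈-atMost (true ∷ S) {suc c} (s≤s S≤) = ∈-++⁺ʳ _ (∈-map⁺ _ (∈-atMost S S≤))

  -- With y = a/N this reads #{S : |S| ≤ c} ≤ (1 + y)^n / y^c, which holds since (1 + y)^n is the sum of y^|S|.
  length-atMost : ∀ {a N} → a ≤ N → ∀ n c → length (atMost n c) * (a ^ c * N ^ n) ≤ N ^ c * (a + N) ^ n
  length-atMost {a} {N} a≤N zero c = begin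
    1 * (a ^ c * 1)    ≡⟨ trans (+-identityʳ _) (*-identityʳ (a ^ c)) ⟩
    a ^ c              ≤⟨ ^-monoˡ-≤ c a≤N ⟩
    N ^ c              ≡⟨ *-identityʳ (N ^ c) ⟨
    N ^ c * 1          ∎
  length-atMost {a} {N} a≤N (suc n) zero = begin
    length (atMost (suc n) zero) * (1 * (N * N ^ n)) ≡⟨ cong (_* (1 * (N * N ^ n))) (length-map (false ∷_) (atMost n zero)) ⟩
    ℓ * (1 * (N * N ^ n))       ≡⟨ swap₁ ℓ N (N ^ n) ⟩
    N * (ℓ * (1 * N ^ n))       ≤⟨ *-mono-≤ (m≤n+m N a) (length-atMost a≤N n 0) ⟩
    (a + N) * (1 * (a + N) ^ n) ≡⟨ swap₂ (a + N) ((a + N) ^ n) ⟩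
    1 * ((a + N) * (a + N) ^ n) ∎
    where
    ℓ = length (atMost n zero)
    swap₁ : ∀ x y z → x * (1 * (y * z)) ≡ y * (x * (1 * z))
    swap₁ = solve-∀
    swap₂ : ∀ x y → x * (1 * y) ≡ 1 * (x * y)
    swap₂ = solve-∀
  length-atMost {a} {N} a≤N (suc n) (suc c) = begin
    length (atMost (suc n) (suc c)) * (a ^ suc c * (N * N ^ n))
      ≡⟨ cong (_* (a ^ suc c * (N * N ^ n))) (trans (length-++ (map (false ∷_) (atMost n (suc c))))
           (cong₂ _+_ (length-map (false ∷_) (atMost n (suc c))) (length-map (true ∷_) (atMost n c)))) ⟩
    (ℓ₀ + ℓ₁) * (a ^ suc c * (N * N ^ n))
      ≡⟨ expand ℓ₀ ℓ₁ a (a ^ c) N (N ^ n) ⟩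
    N * (ℓ₀ * (a ^ suc c * N ^ n)) + a * N * (ℓ₁ * (a ^ c * N ^ n))
      ≤⟨ +-mono-≤ (*-monoʳ-≤ N (length-atMost a≤N n (suc c))) (*-monoʳ-≤ (a * N) (length-atMost a≤N n c)) ⟩
    N * (N ^ suc c * (a + N) ^ n) + a * N * (N ^ c * (a + N) ^ n)
      ≡⟨ collect a N (N ^ c) ((a + N) ^ n) ⟩
    N ^ suc c * (a + N) ^ suc n ∎
    where
    ℓ₀ = length (atMost n (suc c))
    ℓ₁ = length (atMost n c)
    expand : ∀ ℓ₀ ℓ₁ a x N y → (ℓ₀ + ℓ₁) * (a * x * (N * y)) ≡ N * (ℓ₀ * (a * x * y)) + a * N * (ℓ₁ * (x * y))
    expand = solve-∀
    collect : ∀ a N x y → N * (N * x * y) + a * N * (x * y) ≡ N * x * ((a + N) * y)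
    collect = solve-∀

  exactly : ∀ n → ℕ → List (Subset n)
  exactly zero zero = [] ∷ []
  exactly zero (suc s) = []
  exactly (suc n) zero = map (false ∷_) (exactly n zero)
  exactly (suc n) (suc s) = map (false ∷_) (exactly n (suc s)) ++ map (true ∷_) (exactly n s)

  -- The index `s` counts the vertices other than `v`, so the listed edges have size `suc s`.
  through : ∀ {n} → Fin n → ℕ → List (Subset n)
  through zero s = map (true ∷_) (exactly _ s)
  through (suc v) zero = map (false ∷_) (through v zero)
  through (suc v) (suc s) = map (false ∷_) (through v (suc s)) ++ map (true ∷_) (through v s)

  false∷#true∷ : ∀ {n} {xs ys : List (Subset n)} → Disjoint (map (false ∷_) xs) (map (true ∷_) ys)
  false∷#true∷ (e∈ , e∈′) with _ , _ , refl ← ∈-map⁻ _ e∈ | _ , _ , () ← ∈-map⁻ _ e∈′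

  ∷-unique : ∀ {n} b {xs : List (Subset n)} → Unique xs → Unique (map (b ∷_) xs)
  ∷-unique b = map⁺ ∷-injectiveʳ

  exactly-unique : ∀ n s → Unique (exactly n s)
  exactly-unique zero zero = [] ∷ []
  exactly-unique zero (suc s) = []
  exactly-unique (suc n) zero = ∷-unique false (exactly-unique n zero)
  exactly-unique (suc n) (suc s) = ++⁺ (∷-unique false (exactly-unique n (suc s))) (∷-unique true (exactly-unique n s)) false∷#true∷

  ∈-exactly⁺ : ∀ {n} (e : Subset n) → e ∈ₗ exactly n ∣ e ∣
  ∈-exactly⁺ [] = here refl
  ∈-exactly⁺ (true ∷ e) = ∈-++⁺ʳ _ (∈-map⁺ _ (∈-exactly⁺ e))
  ∈-exactly⁺ (false ∷ e) with ∣ e ∣ | ∈-exactly⁺ e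
  ... | zero | e∈ = ∈-map⁺ _ e∈
  ... | suc s | e∈ = ∈-++⁺ˡ (∈-map⁺ _ e∈)

  ∈-exactly⁻ : ∀ n s {e} → e ∈ₗ exactly n s → ∣ e ∣ ≡ s
  ∈-exactly⁻ zero zero (here refl) = refl
  ∈-exactly⁻ (suc n) zero e∈ with _ , e∈ , refl ← ∈-map⁻ _ e∈ = ∈-exactly⁻ n zero e∈
  ∈-exactly⁻ (suc n) (suc s) e∈ with ∈-++⁻ (map (false ∷_) (exactly n (suc s))) e∈
  ... | inj₁ e∈ with _ , e∈ , refl ← ∈-map⁻ _ e∈ = ∈-exactly⁻ n (suc s) e∈
  ... | inj₂ e∈ with _ , e∈ , refl ← ∈-map⁻ _ e∈ = cong suc (∈-exactly⁻ n s e∈)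

  through-unique : ∀ {n} (v : Fin n) s → Unique (through v s)
  through-unique zero s = ∷-unique true (exactly-unique _ s)
  through-unique (suc v) zero = ∷-unique false (through-unique v zero)
  through-unique (suc v) (suc s) = ++⁺ (∷-unique false (through-unique v (suc s))) (∷-unique true (through-unique v s)) false∷#true∷

  ∈-through⁺ : ∀ {n v} {e : Subset n} {s} → ∣ e ∣ ≡ suc s → v ∈ e → e ∈ₗ through v s
  ∈-through⁺ {v = zero} {true ∷ e} eq here with refl ← suc-injective eq = ∈-map⁺ _ (∈-exactly⁺ e)
  ∈-through⁺ {v = suc v} {false ∷ e} {zero} eq (there v∈) = ∈-map⁺ _ (∈-through⁺ eq v∈)
  ∈-through⁺ {v = suc v} {false ∷ e} {suc s} eq (there v∈) = ∈-++⁺ˡ (∈-map⁺ _ (∈-through⁺ eq v∈))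
  ∈-through⁺ {v = suc v} {true ∷ e} {zero} eq (there v∈) = contradiction (subst (1 ≤_) (suc-injective eq) (nonempty v∈)) λ ()
    where
    nonempty : ∀ {n v} {e : Subset n} → v ∈ e → 1 ≤ ∣ e ∣
    nonempty here = s≤s z≤n
    nonempty {e = true ∷ e} (there v∈) = s≤s z≤n
    nonempty {e = false ∷ e} (there v∈) = nonempty v∈
  ∈-through⁺ {v = suc v} {true ∷ e} {suc s} eq (there v∈) = ∈-++⁺ʳ _ (∈-map⁺ _ (∈-through⁺ (suc-injective eq) v∈))

  ∈-through⁻ : ∀ {n} (v : Fin n) s {e} → e ∈ₗ through v s → ∣ e ∣ ≡ suc s × v ∈ e
  ∈-through⁻ zero s e∈ with _ , e∈ , refl ← ∈-map⁻ _ e∈ = cong suc (∈-exactly⁻ _ s e∈) , here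
  ∈-through⁻ (suc v) zero e∈ with _ , e∈ , refl ← ∈-map⁻ _ e∈ =
    proj₁ (∈-through⁻ v zero e∈) , there (proj₂ (∈-through⁻ v zero e∈))
  ∈-through⁻ (suc v) (suc s) e∈ with ∈-++⁻ (map (false ∷_) (through v (suc s))) e∈
  ... | inj₁ e∈ with _ , e∈ , refl ← ∈-map⁻ _ e∈ = proj₁ (∈-through⁻ v (suc s) e∈) , there (proj₂ (∈-through⁻ v (suc s) e∈))
  ... | inj₂ e∈ with _ , e∈ , refl ← ∈-map⁻ _ e∈ = cong suc (proj₁ (∈-through⁻ v s e∈)) , there (proj₂ (∈-through⁻ v s e∈))

  avoiding : ∀ {n} → Subset n → List (Subset n) → ℕ
  avoiding S = count (λ e → disjoint e S)

  module _ {n} (S : Subset n) where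

    avoiding-false∷ : ∀ b xs → avoiding (b ∷ S) (map (false ∷_) xs) ≡ avoiding S xs
    avoiding-false∷ b xs = ∑-map (false ∷_) xs _

    avoiding-true∷-true : ∀ xs → avoiding (true ∷ S) (map (true ∷_) xs) ≡ 0
    avoiding-true∷-true xs = trans (∑-map (true ∷_) xs _) (∑-zero xs)

    avoiding-true∷-false : ∀ xs → avoiding (false ∷ S) (map (true ∷_) xs) ≡ avoiding S xs
    avoiding-true∷-false xs = ∑-map (true ∷_) xs _

    avoiding-++-true : ∀ xs ys → avoiding (true ∷ S) (map (false ∷_) xs ++ map (true ∷_) ys) ≡ avoiding S xs
    avoiding-++-true xs ys = trans (∑-++ (map (false ∷_) xs) _ _)
      (trans (cong₂ _+_ (avoiding-false∷ true xs) (avoiding-true∷-true ys)) (+-identityʳ _))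

    avoiding-++-false : ∀ xs ys → avoiding (false ∷ S) (map (false ∷_) xs ++ map (true ∷_) ys) ≡ avoiding S xs + avoiding S ys
    avoiding-++-false xs ys = trans (∑-++ (map (false ∷_) xs) _ _)
      (cong₂ _+_ (avoiding-false∷ false xs) (avoiding-true∷-false ys))

  pascal : ∀ n k {x y} → x ≡ n C suc k → y ≡ n C k → x + y ≡ suc n C suc k
  pascal n k refl refl = trans (+-comm (n C suc k) (n C k)) (nCk+nC[k+1]≡[n+1]C[k+1] n k)

  avoiding-exactly : ∀ {n} (S : Subset n) s → avoiding S (exactly n s) ≡ ∣ ∁ S ∣ C s
  avoiding-exactly [] zero = refl
  avoiding-exactly [] (suc s) = refl
  avoiding-exactly {suc n} (b ∷ S) zero = trans (avoiding-false∷ S b (exactly n zero)) (avoiding-exactly S zero)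
  avoiding-exactly {suc n} (true ∷ S) (suc s) = trans (avoiding-++-true S (exactly n (suc s)) (exactly n s)) (avoiding-exactly S (suc s))
  avoiding-exactly {suc n} (false ∷ S) (suc s) = trans (avoiding-++-false S (exactly n (suc s)) (exactly n s))
    (pascal ∣ ∁ S ∣ s (avoiding-exactly S (suc s)) (avoiding-exactly S s))

  ∁-nonempty : ∀ {n v} (S : Subset n) → v ∉ S → ∣ ∁ S ∣ ≡ suc (pred ∣ ∁ S ∣)
  ∁-nonempty {v = zero} (true ∷ S) v∉ = contradiction here v∉
  ∁-nonempty {v = suc v} (true ∷ S) v∉ = ∁-nonempty S (v∉ ∘ there)
  ∁-nonempty (false ∷ S) v∉ = refl

  -- The `s` other vertices are chosen outside `S`; `pred` discounts `v`, which lies outside `S` as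
  -- well.
  avoiding-through : ∀ {n} (S : Subset n) {v} s → v ∉ S → avoiding S (through v s) ≡ pred ∣ ∁ S ∣ C s
  avoiding-through {suc n} (true ∷ S) {zero} s v∉ = contradiction here v∉
  avoiding-through {suc n} (false ∷ S) {zero} s v∉ = trans (avoiding-true∷-false S (exactly n s)) (avoiding-exactly S s)
  avoiding-through (b ∷ S) {suc v} zero v∉ = trans (avoiding-false∷ S b (through v zero)) (avoiding-through S zero (v∉ ∘ there))
  avoiding-through (true ∷ S) {suc v} (suc s) v∉ =
    trans (avoiding-++-true S (through v (suc s)) (through v s)) (avoiding-through S (suc s) (v∉ ∘ there))
  avoiding-through (false ∷ S) {suc v} (suc s) v∉ = trans (avoiding-++-false S (through v (suc s)) (through v s))
    (trans (pascal (pred ∣ ∁ S ∣) s (avoiding-through S (suc s) (v∉ ∘ there)) (avoiding-through S s (v∉ ∘ there)))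
      (cong (_C suc s) (sym (∁-nonempty S (v∉ ∘ there)))))

  length-through : ∀ {L} (v : Fin (suc L)) s → length (through v s) ≡ L C s
  length-through {L} v s = begin-equality
    length (through v s)         ≡⟨ count-true (through v s) ⟨
    count (λ _ → true) (through v s) ≡⟨ count-cong (through v s) (λ e → sym (disjoint-⊥ e)) ⟩
    avoiding ⊥ (through v s)     ≡⟨ avoiding-through ⊥ {v} s ∉⊥ ⟩
    pred ∣ ∁ (⊥ {suc L}) ∣ C s   ≡⟨ cong (λ c → pred c C s) (trans (∣∁p∣≡n∸∣p∣ (⊥ {suc L})) (cong (suc L ∸_) (∣⊥∣≡0 (suc L)))) ⟩
    L C s                        ∎

  hits-through : ∀ {L} (S : Subset (suc L)) {v} s → v ∉ S → count (hits S) (through v s) + pred ∣ ∁ S ∣ C s ≡ L C s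
  hits-through S {v} s v∉ = begin-equality
    count (hits S) (through v s) + pred ∣ ∁ S ∣ C s         ≡⟨ cong (count (hits S) (through v s) +_) (avoiding-through S s v∉) ⟨
    count (hits S) (through v s) + avoiding S (through v s) ≡⟨ count-not (λ e → disjoint e S) (through v s) ⟩
    length (through v s)                                    ≡⟨ length-through v s ⟩
    _ ∎

  ∁-size : ∀ {L} (S : Subset (suc L)) {v} → v ∉ S → pred ∣ ∁ S ∣ + ∣ S ∣ ≡ L
  ∁-size {L} S v∉ = suc-injective (begin-equality
    suc (pred ∣ ∁ S ∣) + ∣ S ∣     ≡⟨ cong (_+ ∣ S ∣) (∁-nonempty S v∉) ⟨
    ∣ ∁ S ∣ + ∣ S ∣                ≡⟨ cong (_+ ∣ S ∣) (∣∁p∣≡n∸∣p∣ S) ⟩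
    suc L ∸ ∣ S ∣ + ∣ S ∣          ≡⟨ m∸n+n≡m (∣p∣≤n S) ⟩
    suc L                          ∎)

-- The union bound over all possible obstructions.

module UnionBound where

  open import Data.Bool using (Bool; true; false; _∧_; T)
  open import Data.Bool.ListAction using (all; any)
  open import Data.Fin using (Fin; zero; suc)
  open import Data.Fin.Subset using (Subset; ∣_∣; _∈_; _∉_; ∁)
  open import Data.List using (List; []; _∷_; length; filter; cartesianProduct; upTo)
  open import Data.List.Membership.Propositional using () renaming (_∈_ to _∈ₗ_)
  open import Data.List.Membership.Propositional.Properties using (∈-upTo⁻)
  open import Data.List.Properties using (length-upTo)
  open import Data.List.Relation.Unary.Any using (here)
  open import Data.List.Relation.Unary.Unique.Propositional using (Unique)
  open import Data.List.Relation.Unary.Unique.Propositional.Properties using (filter⁺)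
  import Data.List.Relation.Unary.Unique.DecPropositional as DecUnique
  open import Data.Nat hiding (_≟_)
  open import Data.Nat.Properties hiding (_≟_)
  open import Data.Nat.Combinatorics using (_C_)
  open import Data.Nat.Combinatorics.Base using (_P′_)
  open import Data.Nat.Tactic.RingSolver using (solve-∀)
  open import Data.Product using (_×_; _,_)
  open import Data.Vec using (Vec; tabulate; lookup)
  open import Data.Vec.Properties using (lookup∘tabulate)
  open import Function using (_∘_)
  open import Relation.Binary.PropositionalEquality using (_≡_; refl; sym; trans; cong; cong₂; subst)
  open import Relation.Nullary using (does)
  open import Relation.Unary using (Decidable)
  open import Defs
  open Arithmetic
  open HitProbability
  open Counting
  open Enumeration

  open ≤-Reasoning

  private variable
    A : Set

  ∑-bounded : ∀ (xs : List A) {f : A → ℕ} {c d} → (∀ {x} → x ∈ₗ xs → f x * c ≤ d) → ∑ xs f * c ≤ length xs * d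
  ∑-bounded xs {f} {c} {d} f≤ = begin
    ∑ xs f * c              ≡⟨ *-comm (∑ xs f) c ⟩
    c * ∑ xs f              ≡⟨ ∑-*ˡ xs c f ⟨
    ∑ xs (λ x → c * f x)    ≤⟨ ∑-mono xs (λ {x} x∈ → ≤-trans (≤-reflexive (*-comm c (f x))) (f≤ x∈)) ⟩
    ∑ xs (λ _ → d)          ≡⟨ ∑-const xs d ⟩
    length xs * d           ∎

  count-filter : ∀ {P : A → Set} (P? : Decidable P) (q : A → Bool) xs →
                 count q (filter P? xs) ≡ count (λ x → does (P? x) ∧ q x) xs
  count-filter P? q [] = refl
  count-filter P? q (x ∷ xs) with does (P? x)
  ... | true = cong (𝟙 (q x) +_) (count-filter P? q xs)
  ... | false = count-filter P? q xs

  a≤4^a : ∀ a → a ≤ 4 ^ a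
  a≤4^a zero = z≤n
  a≤4^a (suc a) = begin
    1 + a              ≤⟨ +-mono-≤ (m^n>0 4 a) (a≤4^a a) ⟩
    4 ^ a + 4 ^ a      ≤⟨ +-monoʳ-≤ (4 ^ a) (m≤m+n (4 ^ a) _) ⟩
    4 ^ suc a          ∎

  -- The weight `a / n` serves both families in `length-atMost`: sets of size at most `c` number at
  -- most `(n/a)^c (1 + a/n)^n ≤ (n/a)^c 4^a`, for `c = a` and for `c = r a`. The two factors `4^a`
  -- make `16^a`.
  pair-count : ∀ n r a .{{_ : NonZero n}} → a ≤ n →
               length (atMost n a) * length (atMost n (r * a)) * (a ^ suc r) ^ a ≤ (n ^ suc r) ^ a * 16 ^ a
  pair-count n r a a≤n = begin
    length (atMost n a) * length (atMost n (r * a)) * (a ^ suc r) ^ a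
      ≡⟨ cong (length (atMost n a) * length (atMost n (r * a)) *_) (split a) ⟩
    length (atMost n a) * length (atMost n (r * a)) * (a ^ a * a ^ (r * a))
      ≡⟨ swap (length (atMost n a)) _ (a ^ a) _ ⟩
    length (atMost n a) * a ^ a * (length (atMost n (r * a)) * a ^ (r * a))
      ≤⟨ *-mono-≤ (bound a) (bound (r * a)) ⟩
    n ^ a * 4 ^ a * (n ^ (r * a) * 4 ^ a)
      ≡⟨ swap (n ^ a) (4 ^ a) (n ^ (r * a)) (4 ^ a) ⟩
    n ^ a * n ^ (r * a) * (4 ^ a * 4 ^ a)
      ≡⟨ cong₂ _*_ (split n) (^-distribʳ-* 4 4 a) ⟨
    (n ^ suc r) ^ a * 16 ^ a ∎
    where
    swap : ∀ a b c d → a * b * (c * d) ≡ a * c * (b * d)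
    swap = solve-∀
    assoc : ∀ a b c → a * (b * c) ≡ a * b * c
    assoc = solve-∀
    split : ∀ x → (x ^ suc r) ^ a ≡ x ^ a * x ^ (r * a)
    split x = trans (^-*-assoc x (suc r) a) (^-distribˡ-+-* x a (r * a))
    bound : ∀ c → length (atMost n c) * a ^ c ≤ n ^ c * 4 ^ a
    bound c = *-cancelʳ-≤ _ _ (n ^ n) {{m^n≢0 n n}} (begin
      length (atMost n c) * a ^ c * n ^ n     ≡⟨ *-assoc (length (atMost n c)) _ _ ⟩
      length (atMost n c) * (a ^ c * n ^ n)   ≤⟨ length-atMost a≤n n c ⟩
      n ^ c * (a + n) ^ n                     ≡⟨ cong (λ z → n ^ c * z ^ n) (+-comm a n) ⟩
      n ^ c * (n + a) ^ n                     ≤⟨ *-monoʳ-≤ (n ^ c) ([n+a]^n≤4^a*n^n n a) ⟩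
      n ^ c * (4 ^ a * n ^ n)                 ≡⟨ assoc (n ^ c) (4 ^ a) (n ^ n) ⟩
      n ^ c * 4 ^ a * n ^ n                   ∎)

  -- With `a` the size of `S`, at most `16^a (n/a)^((r+1)a)` pairs, each of probability at most
  -- `((a/n)^(r+3) / 256)^a`, give `16^(-a) (a/n)^(2a)`. As `a ≤ n`, this is at most
  -- `16^(-a) (a/n)²`, and `a² ≤ 16^a` leaves `1/n²`. Hence `256 = 16 * 16`: one factor cancels the
  -- count of pairs, the other absorbs `a²`.
  layer-bound : ∀ {bad pairs total n r} a .{{_ : NonZero n}} → suc a ≤ n →
                bad * (n ^ (3 + r) * 256) ^ suc a ≤ pairs * ((suc a ^ (3 + r)) ^ suc a * total) →
                pairs * (suc a ^ suc r) ^ suc a ≤ (n ^ suc r) ^ suc a * 16 ^ suc a →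
                bad * (n * n) ≤ total
  layer-bound {bad} {pairs} {total} {n} {r} a′ a≤n union pairs≤ =
    *-cancelʳ-≤ _ _ (16 ^ a) {{m^n≢0 16 a}} (begin
      bad * (n * n) * 16 ^ a     ≤⟨ *-cancelʳ-≤ _ _ ((n * n) ^ a′) {{m^n≢0 (n * n) a′ {{m*n≢0 n n}}}} tail ⟩
      total * (a * a)            ≤⟨ *-monoʳ-≤ total (*-mono-≤ (a≤4^a a) (a≤4^a a)) ⟩
      total * (4 ^ a * 4 ^ a)    ≡⟨ cong (total *_) (^-distribʳ-* 4 4 a) ⟨
      total * 16 ^ a             ∎)
    where
    a = suc a′
    expand : ∀ x → (x ^ (3 + r)) ^ a ≡ (x ^ suc r) ^ a * (x * x) ^ a
    expand x = trans (cong (_^ a) (lemma x (x ^ r))) (^-distribʳ-* (x ^ suc r) (x * x) a)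
      where
      lemma : ∀ x y → x * (x * (x * y)) ≡ x * y * (x * x)
      lemma = solve-∀
    head : bad * (n * n) ^ a * 16 ^ a ≤ (a * a) ^ a * total
    head = *-cancelʳ-≤ _ _ ((n ^ suc r) ^ a * 16 ^ a)
      {{m*n≢0 _ _ {{m^n≢0 _ a {{m^n≢0 n (suc r)}}}} {{m^n≢0 16 a}}}} (begin
      bad * (n * n) ^ a * 16 ^ a * ((n ^ suc r) ^ a * 16 ^ a)
        ≡⟨ swap₁ bad ((n * n) ^ a) (16 ^ a) ((n ^ suc r) ^ a) ⟩
      bad * ((n ^ suc r) ^ a * (n * n) ^ a * (16 ^ a * 16 ^ a))
        ≡⟨ cong₂ (λ x y → bad * (x * y)) (expand n) (^-distribʳ-* 16 16 a) ⟨
      bad * ((n ^ (3 + r)) ^ a * 256 ^ a)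
        ≡⟨ cong (bad *_) (^-distribʳ-* (n ^ (3 + r)) 256 a) ⟨
      bad * (n ^ (3 + r) * 256) ^ a
        ≤⟨ union ⟩
      pairs * ((a ^ (3 + r)) ^ a * total)
        ≡⟨ cong (λ x → pairs * (x * total)) (expand a) ⟩
      pairs * ((a ^ suc r) ^ a * (a * a) ^ a * total)
        ≡⟨ swap₂ pairs ((a ^ suc r) ^ a) ((a * a) ^ a) total ⟩
      (a * a) ^ a * total * (pairs * (a ^ suc r) ^ a)
        ≤⟨ *-monoʳ-≤ ((a * a) ^ a * total) pairs≤ ⟩
      (a * a) ^ a * total * ((n ^ suc r) ^ a * 16 ^ a) ∎)
      where
      swap₁ : ∀ b x y z → b * x * y * (z * y) ≡ b * (z * x * (y * y))
      swap₁ = solve-∀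
      swap₂ : ∀ p x y t → p * (x * y * t) ≡ y * t * (p * x)
      swap₂ = solve-∀
    tail : bad * (n * n) * 16 ^ a * (n * n) ^ a′ ≤ total * (a * a) * (n * n) ^ a′
    tail = begin
      bad * (n * n) * 16 ^ a * (n * n) ^ a′     ≡⟨ swap₁ bad (n * n) (16 ^ a) ((n * n) ^ a′) ⟩
      bad * (n * n) ^ a * 16 ^ a                ≤⟨ head ⟩
      (a * a) * (a * a) ^ a′ * total            ≤⟨ *-monoˡ-≤ total (*-monoʳ-≤ (a * a) (^-monoˡ-≤ a′ (*-mono-≤ a≤n a≤n))) ⟩
      (a * a) * (n * n) ^ a′ * total            ≡⟨ swap₂ (a * a) ((n * n) ^ a′) total ⟩
      total * (a * a) * (n * n) ^ a′            ∎
      where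
      swap₁ : ∀ b x y z → b * x * y * z ≡ b * (x * z) * y
      swap₁ = solve-∀
      swap₂ : ∀ x y t → x * y * t ≡ t * x * y
      swap₂ = solve-∀

  module Model (s k L : ℕ) where
    open DecUnique (_≟ₛ_ {suc L}) using (unique?)
    open Distinct (_≟ₛ_ {suc L})

    private
      n = suc L
      r = suc s

    -- Only lists of length exactly `k`: once `k ≤ L C s`, the alternative of too few edges in
    -- `ValidChoice` cannot occur.
    choices : Fin n → List (List (Subset n))
    choices v = filter unique? (words k (through v s))

    outcomes : List (Outcome n)
    outcomes = tuples (tabulate choices)

    pairs : ℕ → List (Subset n × Subset n)
    pairs a = cartesianProduct (atMost n a) (atMost n (r * a))

    -- `atMost` also lists smaller sets; testing the exact size of `S` ties the exponent in
    -- `pair-bound` to the number of independent choices.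
    obstructs : Outcome n → ℕ → Subset n × Subset n → Bool
    obstructs ω a (S , U) = ((∣ S ∣ ≡ᵇ a) ∧ (∣ U ∣ ≤ᵇ r * a) ∧ disjoint S U) ∧ allOn (all (hits U)) S ω

    obstructed : Outcome n → Bool
    -- Shifted by one, `upTo n` runs through the sizes `1` to `n`, so `S` is never empty.
    obstructed ω = any (λ a → any (obstructs ω (suc a)) (pairs (suc a))) (upTo n)

    count-choices : ∀ p v → count (all p) (choices v) ≡ count p (through v s) P′ k
    count-choices p v = trans (count-filter unique? (all p) (words k (through v s))) (count-words p (through-unique v s) k)

    length-choices : ∀ v → length (choices v) ≡ (L C s) P′ k
    length-choices v = begin-equality
      length (choices v)                              ≡⟨ count-true (choices v) ⟨
      count (λ _ → true) (choices v)                  ≡⟨ count-cong (choices v) (sym ∘ all-true) ⟩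
      count (all (λ _ → true)) (choices v)            ≡⟨ count-choices (λ _ → true) v ⟩
      count (λ _ → true) (through v s) P′ k           ≡⟨ cong (_P′ k) (trans (count-true (through v s)) (length-through v s)) ⟩
      (L C s) P′ k                                    ∎
      where
      all-true : ∀ {A : Set} (xs : List A) → all (λ _ → true) xs ≡ true
      all-true [] = refl
      all-true (x ∷ xs) = all-true xs

    module _ (1≤k : 1 ≤ k) (k≤C : k ≤ L C s) (hit-bound : HitBound s k L) where

      private
        F = n ^ (4 + s) * 256

      -- Of the `N P′ k` lists available to `v`, `h P′ k` consist of edges meeting `U`; `P′-ratio`
      -- replaces the quotient by `(h/N)^k`, which `HitBound` controls.
      choice-bound : ∀ S U v → ∣ U ∣ ≤ r * ∣ S ∣ → T (disjoint S U) → v ∈ S →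
                     count (all (hits U)) (choices v) * F ≤ ∣ S ∣ ^ (4 + s) * length (choices v)
      choice-bound S U v U≤ S#U v∈S
        rewrite count-choices (hits U) v | length-choices v =
        *-cancelʳ-≤ _ _ (N ^ k) {{m^n≢0 N k {{>-nonZero (≤-trans 1≤k k≤C)}}}} (begin
          (h P′ k) * F * N ^ k            ≡⟨ swap₁ (h P′ k) F (N ^ k) ⟩
          (h P′ k) * N ^ k * F            ≤⟨ *-monoˡ-≤ F (P′-ratio k (m+n≤o⇒m≤o h (≤-reflexive hits≡))) ⟩
          h ^ k * (N P′ k) * F            ≡⟨ swap₂ (h ^ k) (N P′ k) F ⟩
          (N P′ k) * (h ^ k * F)          ≤⟨ *-monoʳ-≤ (N P′ k) (hit-bound a (∣ U ∣) _ h (∁-size U v∉U) hits≡ U≤ (disjoint-size S U S#U)) ⟩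
          (N P′ k) * (a ^ (4 + s) * N ^ k) ≡⟨ swap₃ (N P′ k) (a ^ (4 + s)) (N ^ k) ⟩
          a ^ (4 + s) * (N P′ k) * N ^ k  ∎)
        where
        a = ∣ S ∣
        N = L C s
        h = count (hits U) (through v s)
        v∉U : v ∉ U
        v∉U = disjoint-∉ S U S#U v∈S
        hits≡ = hits-through U s v∉U
        swap₁ : ∀ x y z → x * y * z ≡ x * z * y
        swap₁ = solve-∀
        swap₂ : ∀ x y z → x * y * z ≡ y * (x * z)
        swap₂ = solve-∀
        swap₃ : ∀ x y z → x * (y * z) ≡ y * x * z
        swap₃ = solve-∀

      pair-bound : ∀ a P → count (λ ω → obstructs ω a P) outcomes * F ^ a ≤ (a ^ (4 + s)) ^ a * length outcomes
      pair-bound a (S , U) with (∣ S ∣ ≡ᵇ a) in S≡ | (∣ U ∣ ≤ᵇ r * a) in U≤ | disjoint S U in S#U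
      ... | false | _ | _ = ≤-trans (≤-reflexive (cong (_* F ^ a) (∑-zero outcomes))) z≤n
      ... | true | false | _ = ≤-trans (≤-reflexive (cong (_* F ^ a) (∑-zero outcomes))) z≤n
      ... | true | true | false = ≤-trans (≤-reflexive (cong (_* F ^ a) (∑-zero outcomes))) z≤n
      ... | true | true | true with refl ← ≡ᵇ⇒≡ ∣ S ∣ a (subst T (sym S≡) _) =
        count-allOn (all (hits U)) S (tabulate choices) F (∣ S ∣ ^ (4 + s)) bound
        where
        bound : ∀ v → v ∈ S → count (all (hits U)) (lookup (tabulate choices) v) * F ≤
                              ∣ S ∣ ^ (4 + s) * length (lookup (tabulate choices) v)
        bound v v∈S rewrite lookup∘tabulate choices v =
          choice-bound S U v (≤ᵇ⇒≤ ∣ U ∣ (r * ∣ S ∣) (subst T (sym U≤) _)) (subst T (sym S#U) _) v∈S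

      -- Each of the `n` possible sizes of `S` contributes a fraction of at most `1/n²`.
      count-obstructed : count obstructed outcomes * n ≤ length outcomes
      count-obstructed = *-cancelʳ-≤ _ _ n (begin
        count obstructed outcomes * n * n         ≡⟨ *-assoc (count obstructed outcomes) n n ⟩
        count obstructed outcomes * (n * n)       ≤⟨ *-monoˡ-≤ (n * n) (count-any (λ a ω → any (obstructs ω (suc a)) (pairs (suc a))) (upTo n) outcomes) ⟩
        ∑ (upTo n) (λ a → bad (suc a)) * (n * n)  ≤⟨ ∑-bounded (upTo n) {λ a → bad (suc a)} {n * n} (λ {a} a∈ → layer a (∈-upTo⁻ a∈)) ⟩
        length (upTo n) * length outcomes         ≡⟨ cong (_* length outcomes) (length-upTo n) ⟩
        n * length outcomes                       ≡⟨ *-comm n (length outcomes) ⟩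
        length outcomes * n                       ∎)
        where
        bad : ℕ → ℕ
        bad a = count (λ ω → any (obstructs ω a) (pairs a)) outcomes
        layer : ∀ a → a < n → bad (suc a) * (n * n) ≤ length outcomes
        layer a a<n = layer-bound {bad (suc a)} {length (atMost n (suc a)) * length (atMost n (r * suc a))} {r = r} a a<n
          (begin
            bad (suc a) * F ^ suc a
              ≤⟨ *-monoˡ-≤ (F ^ suc a) (count-any (λ P ω → obstructs ω (suc a) P) (pairs (suc a)) outcomes) ⟩
            ∑ (pairs (suc a)) (λ P → count (λ ω → obstructs ω (suc a) P) outcomes) * F ^ suc a
              ≤⟨ ∑-bounded (pairs (suc a)) (λ {P} _ → pair-bound (suc a) P) ⟩
            length (pairs (suc a)) * ((suc a ^ (4 + s)) ^ suc a * length outcomes)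
              ≡⟨ cong (_* ((suc a ^ (4 + s)) ^ suc a * length outcomes)) (length-product _,_ (atMost n (suc a)) (atMost n (r * suc a))) ⟩
            length (atMost n (suc a)) * length (atMost n (r * suc a)) * ((suc a ^ (4 + s)) ^ suc a * length outcomes) ∎)
          (pair-count n r (suc a) a<n)

-- Farkas' lemma over the integers.

module FarkasLemma where

  open import Data.Integer as ℤ using (ℤ; +_; 0ℤ; _+_; _*_; -_; _-_; _≤_; _<_)
  import Data.Integer.Properties as ℤ
  open import Data.Integer.Tactic.RingSolver using (solve-∀)
  open import Data.Nat using (z≤n; z<s)
  open import Data.List using (List; []; _∷_)
  open import Data.List.Membership.Propositional using (_∈_; find)
  open import Data.List.Relation.Unary.All.Properties using (¬All⇒Any¬)
  open import Data.List.Relation.Unary.All as All using (All; []; _∷_)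
  open import Data.List.Relation.Unary.AllPairs using ([]; _∷_)
  open import Data.List.Relation.Unary.Any using (Any; here; there)
  open import Data.List.Relation.Unary.Unique.Propositional using (Unique)
  open import Data.Product using (∃; ∃₂; _×_; _,_)
  open import Data.Sum using (_⊎_; inj₁; inj₂)
  open import Function using (_∘_)
  open import Relation.Binary using (DecidableEquality)
  open import Relation.Binary.PropositionalEquality using (_≡_; refl; sym; trans; cong; cong₂; subst; module ≡-Reasoning)
  open import Relation.Nullary using (¬_; yes; no; contradiction)
  open Counting using (module ListSum)

  open ListSum ℤ.+-*-commutativeSemiring public using () renaming
    (∑ to ∑ᶻ; ∑-cong to ∑ᶻ-cong; ∑-+ to ∑ᶻ-+; ∑-*ˡ to ∑ᶻ-*ˡ; ∑-swap to ∑ᶻ-swap; ∑-zero to ∑ᶻ-zero)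

  private variable
    A : Set

  ∑ᶻ-linear : ∀ (xs : List A) p q (f g : A → ℤ) → ∑ᶻ xs (λ x → p * f x + q * g x) ≡ p * ∑ᶻ xs f + q * ∑ᶻ xs g
  ∑ᶻ-linear xs p q f g = trans (∑ᶻ-+ xs _ _) (cong₂ _+_ (∑ᶻ-*ˡ xs p f) (∑ᶻ-*ˡ xs q g))

  ∑ᶻ-nonNeg : ∀ (xs : List A) {f : A → ℤ} → (∀ {x} → x ∈ xs → 0ℤ ≤ f x) → 0ℤ ≤ ∑ᶻ xs f
  ∑ᶻ-nonNeg [] _ = ℤ.≤-refl
  ∑ᶻ-nonNeg (x ∷ xs) 0≤f = ℤ.+-mono-≤ (0≤f (here refl)) (∑ᶻ-nonNeg xs (0≤f ∘ there))

  ∑ᶻ-pos : ∀ {xs : List A} {f : A → ℤ} {y} → (∀ {x} → x ∈ xs → 0ℤ ≤ f x) → y ∈ xs → 0ℤ < f y → 0ℤ < ∑ᶻ xs f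
  ∑ᶻ-pos 0≤f (here refl) 0<fy = ℤ.+-mono-<-≤ 0<fy (∑ᶻ-nonNeg _ (0≤f ∘ there))
  ∑ᶻ-pos 0≤f (there y∈) 0<fy = ℤ.+-mono-≤-< (0≤f (here refl)) (∑ᶻ-pos (0≤f ∘ there) y∈ 0<fy)

  0≤*0≤ : ∀ {i j} → 0ℤ ≤ i → 0ℤ ≤ j → 0ℤ ≤ i * j
  0≤*0≤ {i} {j} 0≤i 0≤j = ℤ.≤-trans (ℤ.≤-reflexive (sym (ℤ.*-zeroʳ i))) (ℤ.*-monoˡ-≤-nonNeg i {{ℤ.nonNegative 0≤i}} 0≤j)

  0<*0< : ∀ {i j} → 0ℤ < i → 0ℤ < j → 0ℤ < i * j
  0<*0< {i} {j} 0<i 0<j = ℤ.≤-<-trans (ℤ.≤-reflexive (sym (ℤ.*-zeroʳ i))) (ℤ.*-monoˡ-<-pos i {{ℤ.positive 0<i}} 0<j)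

  0≤i² : ∀ i → 0ℤ ≤ i * i
  0≤i² (+ n) = 0≤*0≤ {+ n} {+ n} (ℤ.+≤+ z≤n) (ℤ.+≤+ z≤n)
  0≤i² (ℤ.-[1+ n ]) = ℤ.+≤+ z≤n

  module Farkas {X V : Set} (_≟_ : DecidableEquality X) (vs : List V) where

    dot : (V → ℤ) → (V → ℤ) → ℤ
    dot a x = ∑ᶻ vs (λ v → a v * x v)

    -- Membership of `γ` in the rational cone of the generators; `d` is a common denominator of the
    -- coefficients.
    Conic : List X → (X → V → ℤ) → (V → ℤ) → Set
    Conic Es α γ = ∃₂ λ d (u : X → ℤ) → 0ℤ < d × (∀ e → 0ℤ ≤ u e) ×
      (∀ {v} → v ∈ vs → ∑ᶻ Es (λ e → u e * α e v) ≡ d * γ v)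

    Separated : List X → (X → V → ℤ) → (V → ℤ) → Set
    Separated Es α γ = ∃ λ x → (∀ {e} → e ∈ Es → dot (α e) x ≤ 0ℤ) × 0ℤ < dot γ x

    dot-linearˡ : ∀ p q a b x → dot (λ v → p * a v + q * b v) x ≡ p * dot a x + q * dot b x
    dot-linearˡ p q a b x = trans (∑ᶻ-cong vs (λ {v} _ → lemma p q (a v) (b v) (x v))) (∑ᶻ-linear vs p q _ _)
      where
      lemma : ∀ p q a b x → (p * a + q * b) * x ≡ p * (a * x) + q * (b * x)
      lemma = solve-∀

    dot-linearʳ : ∀ p q a x y → dot a (λ v → p * x v + q * y v) ≡ p * dot a x + q * dot a y
    dot-linearʳ p q a x y = trans (∑ᶻ-cong vs (λ {v} _ → lemma p q (a v) (x v) (y v))) (∑ᶻ-linear vs p q _ _)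
      where
      lemma : ∀ p q a x y → a * (p * x + q * y) ≡ p * (a * x) + q * (a * y)
      lemma = solve-∀

    _[_↦_] : (X → ℤ) → X → ℤ → X → ℤ
    (u [ e₀ ↦ c ]) e with e ≟ e₀
    ... | yes _ = c
    ... | no _ = u e

    update-nonNeg : ∀ {u c} e₀ → (∀ e → 0ℤ ≤ u e) → 0ℤ ≤ c → ∀ e → 0ℤ ≤ (u [ e₀ ↦ c ]) e
    update-nonNeg e₀ 0≤u 0≤c e with e ≟ e₀
    ... | yes _ = 0≤c
    ... | no _ = 0≤u e

    ∑ᶻ-update : ∀ {e₀ Es} u c (f : X → ℤ) → Unique (e₀ ∷ Es) →
                ∑ᶻ (e₀ ∷ Es) (λ e → (u [ e₀ ↦ c ]) e * f e) ≡ c * f e₀ + ∑ᶻ Es (λ e → u e * f e)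
    ∑ᶻ-update {e₀} {Es} u c f (e₀∉ ∷ _) = cong₂ _+_ at-e₀ (∑ᶻ-cong Es elsewhere)
      where
      at-e₀ : (u [ e₀ ↦ c ]) e₀ * f e₀ ≡ c * f e₀
      at-e₀ with e₀ ≟ e₀
      ... | yes _ = refl
      ... | no e₀≢e₀ = contradiction refl e₀≢e₀
      elsewhere : ∀ {e} → e ∈ Es → (u [ e₀ ↦ c ]) e * f e ≡ u e * f e
      elsewhere {e} e∈ with e ≟ e₀
      ... | yes refl = contradiction refl (All.lookup e₀∉ e∈)
      ... | no _ = refl

    -- Bartl's induction on the number of generators, with denominators cleared.
    farkas : ∀ Es → Unique Es → ∀ α γ → Conic Es α γ ⊎ Separated Es α γ
    farkas [] _ α γ with All.all? (λ v → γ v ℤ.≟ 0ℤ) vs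
    ... | yes γ≡0 = inj₁ (+ 1 , (λ _ → 0ℤ) , ℤ.+<+ z<s , (λ _ → ℤ.≤-refl) ,
            λ {v} v∈ → sym (trans (ℤ.*-identityˡ (γ v)) (All.lookup γ≡0 v∈)))
    -- Without generators the cone is zero, and a nonzero `γ` separates itself because its square
    -- sum is positive.
    ... | no γ≢0 = inj₂ (γ , (λ ()) , positive (¬All⇒Any¬ (λ v → γ v ℤ.≟ 0ℤ) vs γ≢0))
      where
      0<i² : ∀ i → ¬ i ≡ 0ℤ → 0ℤ < i * i
      0<i² i i≢0 with 0ℤ ℤ.<? i * i
      ... | yes 0<i² = 0<i²
      ... | no 0≮i² with ℤ.i*j≡0⇒i≡0∨j≡0 i (ℤ.≤-antisym (ℤ.≮⇒≥ 0≮i²) (0≤i² i))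
      ... | inj₁ i≡0 = contradiction i≡0 i≢0
      ... | inj₂ i≡0 = contradiction i≡0 i≢0
      positive : Any (λ v → ¬ γ v ≡ 0ℤ) vs → 0ℤ < dot γ γ
      positive nonzero with find nonzero
      ... | v , v∈ , γv≢0 = ∑ᶻ-pos {f = λ v → γ v * γ v} (λ {v} _ → 0≤i² (γ v)) v∈ (0<i² (γ v) γv≢0)
    farkas (e₀ ∷ Es) Es!@(_ ∷ Es!′) α γ with farkas Es Es!′ α γ
    ... | inj₁ (d , u , 0<d , 0≤u , comb) = inj₁ (d , u [ e₀ ↦ 0ℤ ] , 0<d , update-nonNeg e₀ 0≤u ℤ.≤-refl ,
            λ {v} v∈ → trans (∑ᶻ-update u 0ℤ (λ e → α e v) Es!) (trans (ℤ.+-identityˡ _) (comb v∈)))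
    ... | inj₂ (x₀ , α≤0 , 0<γ) with dot (α e₀) x₀ ℤ.≤? 0ℤ
    ... | yes α₀≤0 = inj₂ (x₀ , (λ { (here refl) → α₀≤0 ; (there e∈) → α≤0 e∈ }) , 0<γ)
    ... | no α₀≰0 = eliminate (farkas Es Es!′ (λ e → reduce (α e)) (reduce γ))
      where
      p = dot (α e₀) x₀
      0<p : 0ℤ < p
      0<p = ℤ.≰⇒> α₀≰0
      -- This is `p` times the projection along `α e₀` onto the vectors orthogonal to `x₀`; it sends
      -- `α e₀` to zero and so eliminates that generator.
      reduce : (V → ℤ) → V → ℤ
      reduce a v = p * a v + - dot a x₀ * α e₀ v
      eliminate : Conic Es (λ e → reduce (α e)) (reduce γ) ⊎ Separated Es (λ e → reduce (α e)) (reduce γ) →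
                  Conic (e₀ ∷ Es) α γ ⊎ Separated (e₀ ∷ Es) α γ
      eliminate (inj₁ (d , u , 0<d , 0≤u , comb)) =
        inj₁ (d * p , (λ e → p * u e) [ e₀ ↦ c ] , 0<*0< 0<d 0<p , update-nonNeg e₀ (λ e → 0≤*0≤ (ℤ.<⇒≤ 0<p) (0≤u e)) 0≤c ,
              λ {v} v∈ → trans (∑ᶻ-update (λ e → p * u e) c (λ e → α e v) Es!) (combination v v∈))
        where
        Q = ∑ᶻ Es (λ e → u e * - dot (α e) x₀)
        -- The coefficient of `e₀` restores what the reductions removed. It is nonnegative because
        -- `x₀` is positive on `γ` and nonpositive on the remaining generators.
        c = d * dot γ x₀ + Q
        0≤c : 0ℤ ≤ c
        0≤c = ℤ.+-mono-≤ (ℤ.<⇒≤ (0<*0< 0<d 0<γ)) (∑ᶻ-nonNeg Es (λ {e} e∈ → 0≤*0≤ (0≤u e) (ℤ.neg-mono-≤ (α≤0 e∈))))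
        combination : ∀ v → v ∈ vs → c * α e₀ v + ∑ᶻ Es (λ e → p * u e * α e v) ≡ d * p * γ v
        combination v v∈ = begin
          c * α e₀ v + ∑ᶻ Es (λ e → p * u e * α e v)
            ≡⟨ cong (λ z → c * α e₀ v + z) (trans (∑ᶻ-cong Es (λ {e} _ → ℤ.*-assoc p (u e) (α e v))) (∑ᶻ-*ˡ Es p _)) ⟩
          c * α e₀ v + p * ∑ᶻ Es (λ e → u e * α e v)
            ≡⟨ regroup (d * dot γ x₀) Q (α e₀ v) (p * ∑ᶻ Es (λ e → u e * α e v)) ⟩
          d * dot γ x₀ * α e₀ v + (p * ∑ᶻ Es (λ e → u e * α e v) + α e₀ v * Q)
            ≡⟨ cong (λ z → d * dot γ x₀ * α e₀ v + z) (∑ᶻ-linear Es p (α e₀ v) _ _) ⟨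
          d * dot γ x₀ * α e₀ v + ∑ᶻ Es (λ e → p * (u e * α e v) + α e₀ v * (u e * - dot (α e) x₀))
            ≡⟨ cong (λ z → d * dot γ x₀ * α e₀ v + z) (∑ᶻ-cong Es (λ {e} _ → factor p (u e) (α e v) (α e₀ v) (- dot (α e) x₀))) ⟩
          d * dot γ x₀ * α e₀ v + ∑ᶻ Es (λ e → u e * reduce (α e) v)
            ≡⟨ cong (λ z → d * dot γ x₀ * α e₀ v + z) (comb v∈) ⟩
          d * dot γ x₀ * α e₀ v + d * (p * γ v + - dot γ x₀ * α e₀ v)
            ≡⟨ cancel d (dot γ x₀) (α e₀ v) p (γ v) ⟩
          d * p * γ v ∎
          where
          open ≡-Reasoning
          regroup : ∀ x Q a y → (x + Q) * a + y ≡ x * a + (y + a * Q)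
          regroup = solve-∀
          factor : ∀ p u a a₀ q → p * (u * a) + a₀ * (u * q) ≡ u * (p * a + q * a₀)
          factor = solve-∀
          cancel : ∀ d g a p c → d * g * a + d * (p * c + - g * a) ≡ d * p * c
          cancel = solve-∀
      eliminate (inj₂ (x , α′≤0 , 0<γ′)) = inj₂ (x′ , α≤0′ , subst (0ℤ <_) (sym (transfer γ)) 0<γ′)
        where
        -- The adjoint of `reduce` applied to `x`: pairing with `x′` equals pairing the reduced
        -- vector with `x`. In particular `x′` is orthogonal to `α e₀`.
        x′ : V → ℤ
        x′ v = p * x v + - dot (α e₀) x * x₀ v
        transfer : ∀ a → dot a x′ ≡ dot (reduce a) x
        transfer a = trans (dot-linearʳ p (- dot (α e₀) x) a x x₀)
          (trans (lemma p (dot a x) (dot (α e₀) x) (dot a x₀)) (sym (dot-linearˡ p (- dot a x₀) a (α e₀) x)))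
          where
          lemma : ∀ p y z w → p * y + - z * w ≡ p * y + - w * z
          lemma = solve-∀
        α≤0′ : ∀ {e} → e ∈ e₀ ∷ Es → dot (α e) x′ ≤ 0ℤ
        α≤0′ (here refl) = ℤ.≤-reflexive (trans (dot-linearʳ p (- dot (α e₀) x) (α e₀) x x₀) (lemma p (dot (α e₀) x)))
          where
          lemma : ∀ p z → p * z + - z * p ≡ 0ℤ
          lemma = solve-∀
        α≤0′ {e} (there e∈) = subst (_≤ 0ℤ) (sym (transfer (α e))) (α′≤0 e∈)

-- Weightings nonnegative on edges, compared level by level.

module LayerCake where

  open import Data.Bool using (Bool; true; false; T)
  open import Data.Empty using (⊥)
  open import Data.Fin using (Fin; zero; suc)
  open import Data.Fin.Subset using (Subset; ∣_∣) renaming (_∈_ to _∈ˢ_)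
  open import Data.Fin.Subset.Properties using (_∈?_)
  open import Data.Integer as ℤ using (ℤ; +_; -[1+_]; 0ℤ)
  import Data.Integer.Properties as ℤ
  import Data.Integer.Tactic.RingSolver as ℤ-Solver
  open import Data.List using (List; []; _∷_; length; allFin; filter; downFrom)
  import Data.List as List
  open import Data.List.Membership.Propositional using (_∈_)
  open import Data.List.Membership.Propositional.Properties using (∈-filter⁺; ∈-filter⁻; ∈-allFin; ∈-downFrom⁺)
  open import Data.List.Relation.Unary.Any using (here; there)
  open import Data.List.Properties using (length-downFrom)
  open import Data.Nat
  open import Data.Nat.Properties
  open import Data.Nat.Tactic.RingSolver using (solve-∀)
  open import Data.Product using (∃; _×_; _,_; proj₂)
  open import Data.Vec as Vec using (lookup; tabulate)
  open import Data.Vec.Properties using (lookup∘tabulate; tabulate∘lookup; lookup⇒[]=; []=⇒lookup)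
  open import Function using (_∘_; id)
  open import Relation.Binary.PropositionalEquality using (_≡_; refl; sym; trans; cong; cong₂; subst)
  open import Relation.Nullary using (does; yes; no; contradiction)
  open import Defs using (verticesOf)
  open Counting
  open Enumeration using (disjoint; disjoint-∉; ∉-disjoint)
  open FarkasLemma using (∑ᶻ)

  private variable
    A : Set

  ∑-upper : ∀ {xs : List A} (f : A → ℕ) {x} → x ∈ xs → f x ≤ ∑ xs f
  ∑-upper f (here refl) = m≤m+n _ _
  ∑-upper f (there x∈) = ≤-trans (∑-upper f x∈) (m≤n+m _ _)

  ∑-mono-< : ∀ {xs : List A} {f g : A → ℕ} {y} → (∀ {x} → x ∈ xs → f x ≤ g x) → y ∈ xs → f y < g y → ∑ xs f < ∑ xs g
  ∑-mono-< f≤g (here refl) f<g = +-mono-<-≤ f<g (∑-mono _ (f≤g ∘ there))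
  ∑-mono-< f≤g (there y∈) f<g = +-mono-≤-< (f≤g (here refl)) (∑-mono-< (f≤g ∘ there) y∈ f<g)

  size-tabulate : ∀ {n} (p : A → Bool) (f : Fin n → A) → ∣ tabulate (p ∘ f) ∣ ≡ count p (List.tabulate f)
  size-tabulate {n = zero} p f = refl
  size-tabulate {n = suc n} p f with p (f zero)
  ... | true = cong suc (size-tabulate p (f ∘ suc))
  ... | false = size-tabulate p (f ∘ suc)

  ∈-tabulate⁺ : ∀ {n} {p : Fin n → Bool} {v} → T (p v) → v ∈ˢ tabulate p
  ∈-tabulate⁺ {p = p} {v} pv with p v in eq
  ... | true = lookup⇒[]= v (tabulate p) (trans (lookup∘tabulate p v) eq)

  ∈-tabulate⁻ : ∀ {n} {p : Fin n → Bool} {v} → v ∈ˢ tabulate p → T (p v)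
  ∈-tabulate⁻ {p = p} {v} v∈ = subst T (sym (trans (sym (lookup∘tabulate p v)) ([]=⇒lookup v∈))) _

  ∈-verticesOf⁺ : ∀ {n v} {e : Subset n} → v ∈ˢ e → v ∈ verticesOf e
  ∈-verticesOf⁺ {v = v} {e} v∈ = ∈-filter⁺ (_∈? e) (∈-allFin v) v∈

  ∈-verticesOf⁻ : ∀ {n v} {e : Subset n} → v ∈ verticesOf e → v ∈ˢ e
  ∈-verticesOf⁻ {n} {e = e} v∈ = proj₂ (∈-filter⁻ (_∈? e) {xs = allFin n} v∈)

  does-∈? : ∀ {n} v (e : Subset n) → does (v ∈? e) ≡ lookup e v
  does-∈? zero (true Vec.∷ e) = refl
  does-∈? zero (false Vec.∷ e) = refl
  does-∈? (suc v) (_ Vec.∷ e) = does-∈? v e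

  length-verticesOf : ∀ {n} (e : Subset n) → length (verticesOf e) ≡ ∣ e ∣
  length-verticesOf {n} e = begin-equality
    length (verticesOf e)                    ≡⟨ length-filter≡count (_∈? e) (allFin n) ⟩
    count (λ v → does (v ∈? e)) (allFin n)   ≡⟨ count-cong (allFin n) (λ v → does-∈? v e) ⟩
    count (lookup e) (allFin n)              ≡⟨ size-tabulate (lookup e) id ⟨
    ∣ tabulate (lookup e) ∣                  ≡⟨ cong ∣_∣ (tabulate∘lookup e) ⟩
    ∣ e ∣                                    ∎
    where open ≤-Reasoning

  pos neg : ℤ → ℕ
  pos (+ m) = m
  pos -[1+ m ] = 0
  neg (+ m) = 0
  neg -[1+ m ] = suc m

  pos-neg : ∀ z → z ≡ + pos z ℤ.- + neg z
  pos-neg (+ m) = sym (ℤ.+-identityʳ (+ m))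
  pos-neg -[1+ m ] = refl

  ∑ᶻ-pos-neg : ∀ (xs : List A) (g : A → ℤ) → ∑ᶻ xs g ≡ + ∑ xs (pos ∘ g) ℤ.- + ∑ xs (neg ∘ g)
  ∑ᶻ-pos-neg [] g = refl
  ∑ᶻ-pos-neg (x ∷ xs) g = trans (cong₂ ℤ._+_ (pos-neg (g x)) (∑ᶻ-pos-neg xs g))
    (lemma (+ pos (g x)) (+ neg (g x)) (+ ∑ xs (pos ∘ g)) (+ ∑ xs (neg ∘ g)))
    where
    lemma : ∀ a b c d → (a ℤ.- b) ℤ.+ (c ℤ.- d) ≡ (a ℤ.+ c) ℤ.- (b ℤ.+ d)
    lemma = ℤ-Solver.solve-∀

  <neg⇒ : ∀ {k} z → k < neg z → + k ℤ.+ z ℤ.< 0ℤ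
  <neg⇒ {k} -[1+ m ] k< = ℤ.<-≤-trans (ℤ.+-monoˡ-< -[1+ m ] (ℤ.+<+ k<)) (ℤ.≤-reflexive (ℤ.n⊖n≡0 (suc m)))

  pos≤⇒ : ∀ {t} z → pos z ≤ t → z ℤ.≤ + t
  pos≤⇒ (+ m) p = ℤ.+≤+ p
  pos≤⇒ -[1+ m ] p = ℤ.-≤+

  -- One term is kept and all others are replaced by the cap `t`; the `t` added on the left avoids
  -- subtracting one from the length.
  ∑ᶻ-upper : ∀ {xs : List A} (g : A → ℤ) {t v} → (∀ {u} → u ∈ xs → g u ℤ.≤ t) → v ∈ xs →
             ∑ᶻ xs g ℤ.+ t ℤ.≤ + length xs ℤ.* t ℤ.+ g v
  ∑ᶻ-upper {xs = x ∷ xs} g {t} g≤ (here refl) = begin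
    (g x ℤ.+ ∑ᶻ xs g) ℤ.+ t                  ≤⟨ ℤ.+-monoˡ-≤ t (ℤ.+-monoʳ-≤ (g x) (bound xs (g≤ ∘ there))) ⟩
    (g x ℤ.+ + length xs ℤ.* t) ℤ.+ t        ≡⟨ lemma (g x) (+ length xs) t ⟩
    (ℤ.1ℤ ℤ.+ + length xs) ℤ.* t ℤ.+ g x     ∎
    where
    open ℤ.≤-Reasoning
    lemma : ∀ a l t → (a ℤ.+ l ℤ.* t) ℤ.+ t ≡ (ℤ.1ℤ ℤ.+ l) ℤ.* t ℤ.+ a
    lemma = ℤ-Solver.solve-∀
    step : ∀ l t → t ℤ.+ l ℤ.* t ≡ (ℤ.1ℤ ℤ.+ l) ℤ.* t
    step = ℤ-Solver.solve-∀
    bound : ∀ xs → (∀ {u} → u ∈ xs → g u ℤ.≤ t) → ∑ᶻ xs g ℤ.≤ + length xs ℤ.* t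
    bound [] _ = ℤ.≤-refl
    bound (x ∷ xs) g≤ = ℤ.≤-trans (ℤ.+-mono-≤ (g≤ (here refl)) (bound xs (g≤ ∘ there))) (ℤ.≤-reflexive (step (+ length xs) t))
  ∑ᶻ-upper {xs = x ∷ xs} g {t} {v} g≤ (there v∈) = begin
    (g x ℤ.+ ∑ᶻ xs g) ℤ.+ t                    ≡⟨ ℤ.+-assoc (g x) (∑ᶻ xs g) t ⟩
    g x ℤ.+ (∑ᶻ xs g ℤ.+ t)                    ≤⟨ ℤ.+-mono-≤ (g≤ (here refl)) (∑ᶻ-upper g (g≤ ∘ there) v∈) ⟩
    t ℤ.+ (+ length xs ℤ.* t ℤ.+ g v)          ≡⟨ lemma t (+ length xs) (g v) ⟩
    (ℤ.1ℤ ℤ.+ + length xs) ℤ.* t ℤ.+ g v       ∎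
    where
    open ℤ.≤-Reasoning
    lemma : ∀ t l a → t ℤ.+ (l ℤ.* t ℤ.+ a) ≡ (ℤ.1ℤ ℤ.+ l) ℤ.* t ℤ.+ a
    lemma = ℤ-Solver.solve-∀

  open ≤-Reasoning

  <ᵇ-false : ∀ {m n} → (m <ᵇ n) ≡ false → n ≤ m
  <ᵇ-false {m} {n} eq = ≮⇒≥ λ m<n → subst T eq (<⇒<ᵇ m<n)

  -- Exactly the smaller of `H` and `f` many levels `t < H` lie below `f`.
  layers-≤ : ∀ H f → ∑ (downFrom H) (λ t → 𝟙 (t <ᵇ f)) ≤ f
  layers-≤ zero f = z≤n
  layers-≤ (suc H) f with H <ᵇ f in eq
  ... | false = layers-≤ H f
  ... | true = begin
    suc (∑ (downFrom H) (λ t → 𝟙 (t <ᵇ f)))     ≤⟨ s≤s (∑-mono (downFrom H) (λ {t} _ → 𝟙≤1 (t <ᵇ f))) ⟩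
    suc (∑ (downFrom H) (λ _ → 1))              ≡⟨ cong suc (trans (∑-const (downFrom H) 1) (trans (*-identityʳ _) (length-downFrom H))) ⟩
    suc H                                       ≤⟨ <ᵇ⇒< H f (subst T (sym eq) _) ⟩
    f                                           ∎
    where
    𝟙≤1 : ∀ b → 𝟙 b ≤ 1
    𝟙≤1 true = ≤-refl
    𝟙≤1 false = z≤n

  -- For positive `r`, about `f / r` multiples of `r`, rounded up, lie below `f`. The minimum with
  -- `r * H` makes the induction on `H` possible; it disappears once `H` is large.
  layers-≥ : ∀ r H f → f ⊓ (r * H) ≤ r * ∑ (downFrom H) (λ t → 𝟙 (r * t <ᵇ f))
  layers-≥ r zero f = m⊓n≤n f (r * 0)
  layers-≥ r (suc H) f with r * H <ᵇ f in eq
  ... | true = begin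
    f ⊓ (r * suc H)                                        ≤⟨ m⊓n≤n f (r * suc H) ⟩
    r * suc H                                              ≡⟨ *-suc r H ⟩
    r + r * H                                              ≡⟨ cong (λ z → r + z) (m≥n⇒m⊓n≡n (<⇒≤ (<ᵇ⇒< (r * H) f (subst T (sym eq) _)))) ⟨
    r + f ⊓ (r * H)                                        ≤⟨ +-monoʳ-≤ r (layers-≥ r H f) ⟩
    r + r * ∑ (downFrom H) (λ t → 𝟙 (r * t <ᵇ f))          ≡⟨ *-suc r _ ⟨
    r * suc (∑ (downFrom H) (λ t → 𝟙 (r * t <ᵇ f)))        ∎
  ... | false = begin
    f ⊓ (r * suc H)                                        ≤⟨ m⊓n≤m f (r * suc H) ⟩
    f                                                      ≡⟨ m≤n⇒m⊓n≡m (<ᵇ-false eq) ⟨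
    f ⊓ (r * H)                                            ≤⟨ layers-≥ r H f ⟩
    r * ∑ (downFrom H) (λ t → 𝟙 (r * t <ᵇ f))              ∎

  -- The absence of obstructions in positive form, so that a witnessing edge is at hand.
  Expanding : ∀ {n} → ℕ → List (Subset n) → Set
  Expanding r Es = ∀ S U → 1 ≤ ∣ S ∣ → ∣ U ∣ ≤ r * ∣ S ∣ → T (disjoint S U) →
    ∃ λ e → e ∈ Es × T (disjoint e U) × ∃ λ v → v ∈ˢ S × v ∈ˢ e

  module Balance {n} (s : ℕ) (Es : List (Subset n)) (uniform : ∀ {e} → e ∈ Es → ∣ e ∣ ≡ suc s)
                 (expanding : Expanding (suc s) Es)
                 (g : Fin n → ℤ) (g≥0 : ∀ {e} → e ∈ Es → 0ℤ ℤ.≤ ∑ᶻ (verticesOf e) g) where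

    private
      r = suc s
      isLow isHigh : ℕ → Fin n → Bool
      isLow t v = r * t <ᵇ neg (g v)
      isHigh t v = t <ᵇ pos (g v)
      low high : ℕ → Subset n
      low t = tabulate (isLow t)
      high t = tabulate (isHigh t)

    low#high : ∀ t → T (disjoint (low t) (high t))
    low#high t = ∉-disjoint (low t) (high t) (λ v∈low v∈high → exclusive _ (∈-tabulate⁻ v∈low) (∈-tabulate⁻ v∈high))
      where
      exclusive : ∀ v → T (isLow t v) → T (isHigh t v) → ⊥
      exclusive v l h with g v
      exclusive v l () | -[1+ m ]

    -- An edge with a vertex below -r t and none above t has negative weight.
    high-dominates : ∀ t → 1 ≤ ∣ low t ∣ → r * ∣ low t ∣ < ∣ high t ∣
    high-dominates t 1≤low with r * ∣ low t ∣ <? ∣ high t ∣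
    ... | yes dominates = dominates
    ... | no small with e , e∈ , e#high , v , v∈low , v∈e ← expanding (low t) (high t) 1≤low (≮⇒≥ small) (low#high t) =
      contradiction (ℤ.+-mono-≤ (g≥0 e∈) (ℤ.+≤+ (z≤n {t}))) (ℤ.<⇒≱ negative)
      where
      capped : ∀ {u} → u ∈ verticesOf e → g u ℤ.≤ + t
      capped {u} u∈ with isHigh t u in eq
      ... | true = contradiction (∈-tabulate⁺ (subst T (sym eq) _)) (disjoint-∉ e (high t) e#high (∈-verticesOf⁻ u∈))
      ... | false = pos≤⇒ (g u) (<ᵇ-false eq)
      negative : ∑ᶻ (verticesOf e) g ℤ.+ + t ℤ.< 0ℤ
      negative = ℤ.≤-<-trans (∑ᶻ-upper g capped (∈-verticesOf⁺ v∈e)) (ℤ.≤-<-trans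
        (ℤ.≤-reflexive (cong (ℤ._+ g v) (trans (cong (λ l → + l ℤ.* + t) (trans (length-verticesOf e) (uniform e∈))) (sym (ℤ.pos-* r t)))))
        (<neg⇒ (g v) (<ᵇ⇒< (r * t) (neg (g v)) (∈-tabulate⁻ v∈low))))

    high-dominates-weakly : ∀ t → r * ∣ low t ∣ ≤ ∣ high t ∣
    high-dominates-weakly t with ∣ low t ∣ in eq
    ... | zero = ≤-trans (≤-reflexive (*-zeroʳ r)) z≤n
    ... | suc _ = <⇒≤ (subst (λ l → r * l < ∣ high t ∣) eq (high-dominates t (subst (1 ≤_) (sym eq) (s≤s z≤n))))

    private
      V = allFin n
      N height : ℕ
      N = ∑ V (neg ∘ g)
      -- Large enough to reach every `neg (g v)`, and positive even when `N` is zero, so that level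
      -- `0` is always among the layers.
      height = suc N

    -- The levels at which a vertex is low, weighted by `r`, cover its negative part; exchanging the
    -- sums regroups them by level.
    negative-≤-layers : N ≤ ∑ (downFrom height) (λ t → r * ∣ low t ∣)
    negative-≤-layers = begin
      ∑ V (neg ∘ g)
        ≤⟨ ∑-mono V (λ {v} v∈ → below v v∈) ⟩
      ∑ V (λ v → r * ∑ (downFrom height) (λ t → 𝟙 (isLow t v)))
        ≡⟨ ∑-cong V (λ {v} _ → sym (∑-*ˡ (downFrom height) r _)) ⟩
      ∑ V (λ v → ∑ (downFrom height) (λ t → r * 𝟙 (isLow t v)))
        ≡⟨ ∑-swap V (downFrom height) _ ⟩
      ∑ (downFrom height) (λ t → ∑ V (λ v → r * 𝟙 (isLow t v)))
        ≡⟨ ∑-cong (downFrom height) (λ {t} _ → trans (∑-*ˡ V r _) (cong (r *_) (sym (size-tabulate (isLow t) id)))) ⟩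
      ∑ (downFrom height) (λ t → r * ∣ low t ∣) ∎
      where
      below : ∀ v → v ∈ V → neg (g v) ≤ r * ∑ (downFrom height) (λ t → 𝟙 (isLow t v))
      below v v∈ = begin
        neg (g v)                         ≡⟨ m≤n⇒m⊓n≡m (≤-trans (∑-upper (neg ∘ g) v∈) (≤-trans (n≤1+n N) (m≤n*m height r))) ⟨
        neg (g v) ⊓ (r * height)          ≤⟨ layers-≥ r height (neg (g v)) ⟩
        r * ∑ (downFrom height) (λ t → 𝟙 (isLow t v)) ∎

    layers-≤-positive : ∑ (downFrom height) (λ t → ∣ high t ∣) ≤ ∑ V (pos ∘ g)
    layers-≤-positive = begin
      ∑ (downFrom height) (λ t → ∣ high t ∣)
        ≡⟨ ∑-cong (downFrom height) (λ {t} _ → size-tabulate (isHigh t) id) ⟩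
      ∑ (downFrom height) (λ t → ∑ V (λ v → 𝟙 (isHigh t v)))
        ≡⟨ ∑-swap (downFrom height) V _ ⟩
      ∑ V (λ v → ∑ (downFrom height) (λ t → 𝟙 (isHigh t v)))
        ≤⟨ ∑-mono V (λ {v} _ → layers-≤ height (pos (g v))) ⟩
      ∑ V (pos ∘ g) ∎

    total-nonNeg : 0ℤ ℤ.≤ ∑ᶻ V g
    total-nonNeg = subst (0ℤ ℤ.≤_) (sym (∑ᶻ-pos-neg V g)) (ℤ.i≤j⇒0≤j-i (ℤ.+≤+ (begin
      N                                             ≤⟨ negative-≤-layers ⟩
      ∑ (downFrom height) (λ t → r * ∣ low t ∣)     ≤⟨ ∑-mono (downFrom height) (λ {t} _ → high-dominates-weakly t) ⟩
      ∑ (downFrom height) (λ t → ∣ high t ∣)        ≤⟨ layers-≤-positive ⟩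
      ∑ V (pos ∘ g)                                 ∎)))

    -- A nonempty `low 0` would make the comparison strict at level `0` and the total positive. So
    -- no value is negative, and a total of at most zero leaves only zeros.
    total-zero : ∑ᶻ V g ℤ.≤ 0ℤ → ∀ v → g v ≡ 0ℤ
    total-zero total≤0 v = trans (pos-neg (g v)) (cong₂ (λ p q → + p ℤ.- + q) (vanish pos positive≡0 v) (vanish neg N≡0 v))
      where
      positive≤N : ∑ V (pos ∘ g) ≤ N
      positive≤N = ℤ.drop‿+≤+ (ℤ.i-j≤0⇒i≤j (subst (ℤ._≤ 0ℤ) (∑ᶻ-pos-neg V g) total≤0))
      low-empty : ∣ low 0 ∣ ≡ 0
      low-empty with ∣ low 0 ∣ in eq
      ... | zero = refl
      ... | suc _ = contradiction positive≤N (<⇒≱ (begin-strict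
        N                                             ≤⟨ negative-≤-layers ⟩
        ∑ (downFrom height) (λ t → r * ∣ low t ∣)
          <⟨ ∑-mono-< (λ {t} _ → high-dominates-weakly t) (∈-downFrom⁺ (s≤s z≤n)) (high-dominates 0 (subst (1 ≤_) (sym eq) (s≤s z≤n))) ⟩
        ∑ (downFrom height) (λ t → ∣ high t ∣)        ≤⟨ layers-≤-positive ⟩
        ∑ V (pos ∘ g)                                 ∎))
      vanish : ∀ (f : ℤ → ℕ) → ∑ V (f ∘ g) ≡ 0 → ∀ v → f (g v) ≡ 0
      vanish f ∑≡0 v = n≤0⇒n≡0 (≤-trans (∑-upper (f ∘ g) (∈-allFin v)) (≤-reflexive ∑≡0))
      neg≡0 : ∀ v → neg (g v) ≡ 0
      neg≡0 v = n≤0⇒n≡0 (≮⇒≥ λ 0<neg → contradiction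
        (≤-trans (≤-trans (𝟙-true (isLow 0 v) (<⇒<ᵇ (subst (_< neg (g v)) (sym (*-zeroʳ r)) 0<neg)))
          (∑-upper (𝟙 ∘ isLow 0) (∈-allFin v))) (≤-reflexive (trans (sym (size-tabulate (isLow 0) id)) low-empty)))
        λ ())
        where
        𝟙-true : ∀ b → T b → 1 ≤ 𝟙 b
        𝟙-true true _ = ≤-refl
      N≡0 : N ≡ 0
      N≡0 = trans (∑-cong V (λ {v} _ → neg≡0 v)) (∑-zero V)
      positive≡0 : ∑ V (pos ∘ g) ≡ 0
      positive≡0 = n≤0⇒n≡0 (≤-trans positive≤N (≤-reflexive N≡0))

-- From expansion to the perfect fractional matching and the unique cover.

module FractionalDuality where

  open import Data.Bool using (true; false)
  open import Data.Fin using (Fin; zero; suc)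
  open import Data.Fin.Subset using (Subset; ∣_∣) renaming (_∈_ to _∈ˢ_)
  open import Data.Fin.Subset.Properties using (_∈?_)
  open import Data.Integer as ℤ using (ℤ; +_; 0ℤ; 1ℤ)
  import Data.Integer.Properties as ℤ
  open import Data.Integer.Tactic.RingSolver using (solve-∀)
  open import Data.List using (List; []; _∷_; length; map; filter; allFin)
  open import Data.List.Properties using (length-tabulate)
  open import Data.List.Membership.Propositional using (_∈_)
  open import Data.List.Membership.Propositional.Properties using (∈-allFin; ∈-filter⁺)
  open import Data.List.Relation.Unary.All as All using (All)
  open import Data.List.Relation.Unary.Any using (here; there)
  open import Data.List.Relation.Unary.Unique.Propositional using (Unique)
  open import Data.Nat as ℕ using (ℕ; zero; suc)
  open import Data.Product using (∃; ∃₂; _,_; proj₁; proj₂)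
  open import Data.Rational as ℚ using (ℚ; 1ℚ; _/_; ↥_)
  import Data.Rational.Properties as ℚ
  open import Data.Rational.Unnormalised as ℚᵘ using (ℚᵘ; mkℚᵘ; *≡*; *≤*)
  import Data.Rational.Unnormalised.Properties as ℚᵘ
  open import Data.Sum using (inj₁; inj₂)
  open import Data.Vec using ([]; _∷_; here; there)
  open import Function using (_∘_; id)
  open import Relation.Binary.PropositionalEquality using (_≡_; refl; sym; trans; cong; cong₂; subst; subst₂; module ≡-Reasoning)
  open import Relation.Nullary using (¬_; does; contradiction)
  open import Relation.Unary using (Decidable)
  open import Defs
  open Counting using (𝟙)
  open FarkasLemma
  open LayerCake

  private variable
    A : Set

  /-≡⁺ : ∀ {a b c d} → a ℤ.* + suc d ≡ b ℤ.* + suc c → a / suc c ≡ b / suc d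
  /-≡⁺ {a} {b} {c} {d} eq = ℚ.fromℚᵘ-cong {mkℚᵘ a c} {mkℚᵘ b d} (*≡* eq)

  /-≡⁻ : ∀ {a b c d} → a / suc c ≡ b / suc d → a ℤ.* + suc d ≡ b ℤ.* + suc c
  /-≡⁻ {a} {b} {c} {d} eq = ℚᵘ.drop-*≡* (ℚ.fromℚᵘ-injective {mkℚᵘ a c} {mkℚᵘ b d} eq)

  /-≤⁺ : ∀ {a b c d} → a ℤ.* + suc d ℤ.≤ b ℤ.* + suc c → a / suc c ℚ.≤ b / suc d
  /-≤⁺ {a} {b} {c} {d} le = ℚ.toℚᵘ-cancel-≤ (ℚᵘ.≤-respˡ-≃ (ℚᵘ.≃-sym (ℚ.toℚᵘ-fromℚᵘ (mkℚᵘ a c)))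
    (ℚᵘ.≤-respʳ-≃ (ℚᵘ.≃-sym (ℚ.toℚᵘ-fromℚᵘ (mkℚᵘ b d))) (*≤* le)))

  /-≤⁻ : ∀ {a b c d} → a / suc c ℚ.≤ b / suc d → a ℤ.* + suc d ℤ.≤ b ℤ.* + suc c
  /-≤⁻ {a} {b} {c} {d} le = ℚᵘ.drop-*≤* (ℚᵘ.≤-respˡ-≃ (ℚ.toℚᵘ-fromℚᵘ (mkℚᵘ a c))
    (ℚᵘ.≤-respʳ-≃ (ℚ.toℚᵘ-fromℚᵘ (mkℚᵘ b d)) (ℚ.toℚᵘ-mono-≤ le)))

  /-+ : ∀ a b d → a / suc d ℚ.+ b / suc d ≡ (a ℤ.+ b) / suc d
  /-+ a b d = ℚ.toℚᵘ-injective (begin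
    ℚ.toℚᵘ (a / suc d ℚ.+ b / suc d)                 ≈⟨ ℚ.toℚᵘ-homo-+ (a / suc d) (b / suc d) ⟩
    ℚ.toℚᵘ (a / suc d) ℚᵘ.+ ℚ.toℚᵘ (b / suc d)       ≈⟨ ℚᵘ.+-cong (ℚ.toℚᵘ-fromℚᵘ (mkℚᵘ a d)) (ℚ.toℚᵘ-fromℚᵘ (mkℚᵘ b d)) ⟩
    mkℚᵘ a d ℚᵘ.+ mkℚᵘ b d                           ≈⟨ *≡* (lemma a b (+ suc d)) ⟩
    mkℚᵘ (a ℤ.+ b) d                                 ≈⟨ ℚᵘ.≃-sym (ℚ.toℚᵘ-fromℚᵘ (mkℚᵘ (a ℤ.+ b) d)) ⟩
    ℚ.toℚᵘ ((a ℤ.+ b) / suc d)                       ∎)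
    where
    open ℚᵘ.≃-Reasoning
    lemma : ∀ a b d → (a ℤ.* d ℤ.+ b ℤ.* d) ℤ.* d ≡ (a ℤ.+ b) ℤ.* (d ℤ.* d)
    lemma = solve-∀

  Σℚ-/ : ∀ (xs : List A) (f : A → ℤ) d → Σℚ (map (λ x → f x / suc d) xs) ≡ ∑ᶻ xs f / suc d
  Σℚ-/ [] f d = sym (ℚ.0/n≡0 (suc d))
  Σℚ-/ (x ∷ xs) f d = trans (cong (f x / suc d ℚ.+_) (Σℚ-/ xs f d)) (/-+ (f x) (∑ᶻ xs f) d)

  Σℚ-cong : ∀ (xs : List A) {f g : A → ℚ} → (∀ x → f x ≡ g x) → Σℚ (map f xs) ≡ Σℚ (map g xs)
  Σℚ-cong [] _ = refl
  Σℚ-cong (x ∷ xs) f≡g = cong₂ ℚ._+_ (f≡g x) (Σℚ-cong xs f≡g)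

  -- The level argument works with integer weights; this carries a rational cover there.
  common-denominator : ∀ {n} (w : Fin n → ℚ) → ∃₂ λ d (W : Fin n → ℤ) → ∀ v → w v ≡ W v / suc d
  common-denominator {zero} w = 0 , (λ ()) , λ ()
  -- The successor of this number is `suc d * suc e`.
  common-denominator {suc n} w = e ℕ.+ d ℕ.* suc e , W′ , w≡
    where
    rest = common-denominator (w ∘ suc)
    d = proj₁ rest
    W = proj₁ (proj₂ rest)
    p = w zero
    e = ℚ.ℚ.denominator-1 p
    W′ : Fin (suc n) → ℤ
    W′ zero = ↥ p ℤ.* + suc d
    W′ (suc v) = W v ℤ.* + suc e
    product≡ : + suc (e ℕ.+ d ℕ.* suc e) ≡ + suc d ℤ.* + suc e
    product≡ = ℤ.pos-* (suc d) (suc e)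
    w≡ : ∀ v → w v ≡ W′ v / suc (e ℕ.+ d ℕ.* suc e)
    w≡ zero = trans (sym (ℚ.↥p/↧p≡p p)) (/-≡⁺ {↥ p} {W′ zero} (trans (cong (↥ p ℤ.*_) product≡) (sym (ℤ.*-assoc (↥ p) (+ suc d) (+ suc e)))))
    w≡ (suc v) = trans (proj₂ (proj₂ rest) v) (/-≡⁺ {W v} {W′ (suc v)} (trans (cong (W v ℤ.*_) product≡) (lemma (W v) (+ suc d) (+ suc e))))
      where
      lemma : ∀ x d e → x ℤ.* (d ℤ.* e) ≡ x ℤ.* e ℤ.* d
      lemma = solve-∀

  ∑ᶻ-filter : ∀ {P : A → Set} (P? : Decidable P) xs (f : A → ℤ) →
              ∑ᶻ (filter P? xs) f ≡ ∑ᶻ xs (λ x → f x ℤ.* + 𝟙 (does (P? x)))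
  ∑ᶻ-filter P? [] f = refl
  ∑ᶻ-filter P? (x ∷ xs) f with does (P? x)
  ... | true = cong₂ ℤ._+_ (sym (ℤ.*-identityʳ (f x))) (∑ᶻ-filter P? xs f)
  ... | false = trans (∑ᶻ-filter P? xs f) (sym (trans (cong (ℤ._+ _) (ℤ.*-zeroʳ (f x))) (ℤ.+-identityˡ _)))

  ∑ᶻ-1 : ∀ (xs : List A) → ∑ᶻ xs (λ _ → 1ℤ) ≡ + length xs
  ∑ᶻ-1 [] = refl
  ∑ᶻ-1 (x ∷ xs) = cong (ℤ._+_ 1ℤ) (∑ᶻ-1 xs)

  ∑ᶻ-member : ∀ {xs : List A} {f : A → ℤ} {y} → (∀ {x} → x ∈ xs → 0ℤ ℤ.≤ f x) → y ∈ xs → f y ℤ.≤ ∑ᶻ xs f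
  ∑ᶻ-member {f = f} 0≤f (here refl) = ℤ.≤-trans (ℤ.≤-reflexive (sym (ℤ.+-identityʳ _))) (ℤ.+-monoʳ-≤ (f _) (∑ᶻ-nonNeg _ (0≤f ∘ there)))
  ∑ᶻ-member {xs = x ∷ xs} {f} 0≤f (there y∈) = ℤ.≤-trans (∑ᶻ-member (0≤f ∘ there) y∈)
    (ℤ.≤-trans (ℤ.≤-reflexive (sym (ℤ.+-identityˡ _))) (ℤ.+-monoˡ-≤ (∑ᶻ xs f) (0≤f (here refl))))

  nonempty : ∀ {n} (e : Subset n) {m} → ∣ e ∣ ≡ suc m → ∃ λ v → v ∈ˢ e
  nonempty (true ∷ e) _ = zero , here
  nonempty (false ∷ e) eq = suc (proj₁ (nonempty e eq)) , there (proj₂ (nonempty e eq))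

  length-allFin : ∀ n → length (allFin n) ≡ n
  length-allFin n = length-tabulate {n = n} id

  module _ {n} (s : ℕ) (Es : List (Subset n)) (Es! : Unique Es) (uniform : ∀ {e} → e ∈ Es → ∣ e ∣ ≡ suc s)
           (expanding : Expanding (suc s) Es) where

    private
      r = suc s
      V = allFin n
      ∈ᶻ : Subset n → Fin n → ℤ
      ∈ᶻ e v = + 𝟙 (does (v ∈? e))

    open Farkas (_≟ₛ_ {n}) V

    -- A separating vector would be nonpositive on every edge with positive total; its negative
    -- contradicts `total-nonNeg`.
    not-separated : ¬ Separated Es ∈ᶻ (λ _ → 1ℤ)
    not-separated (x , edges≤0 , total>0) = contradiction
      (subst (0ℤ ℤ.≤_) (total V) (Balance.total-nonNeg s Es uniform expanding g edge-nonNeg))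
      (ℤ.<⇒≱ (ℤ.neg-mono-< (subst (0ℤ ℤ.<_) (∑ᶻ-cong V (λ {v} _ → ℤ.*-identityˡ (x v))) total>0)))
      where
      g : Fin n → ℤ
      g v = ℤ.- 1ℤ ℤ.* x v
      total : ∀ xs → ∑ᶻ xs g ≡ ℤ.- ∑ᶻ xs x
      total xs = trans (∑ᶻ-*ˡ xs (ℤ.- 1ℤ) x) (ℤ.-1*i≡-i (∑ᶻ xs x))
      edge-nonNeg : ∀ {e} → e ∈ Es → 0ℤ ℤ.≤ ∑ᶻ (verticesOf e) g
      edge-nonNeg {e} e∈ = subst (0ℤ ℤ.≤_) (sym (total (verticesOf e))) (ℤ.neg-mono-≤ (subst (ℤ._≤ 0ℤ) (sym
        (trans (∑ᶻ-filter (_∈? e) V x) (∑ᶻ-cong V (λ {v} _ → ℤ.*-comm (x v) (∈ᶻ e v))))) (edges≤0 e∈)))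

    -- Dividing `u` by its denominator saturates every vertex. Counting incidences in two ways gives
    -- the weight `n / r`, and `φ e ≤ 1` holds because `e` has a vertex, where `φ e` is one summand
    -- of a sum equal to `1`.
    perfect-matching : Conic Es ∈ᶻ (λ _ → 1ℤ) → ∃ λ φ → IsPerfectFractionalMatching n r Es φ
    perfect-matching (+ suc d , u , _ , 0≤u , balanced) =
      φ , (All.tabulate (λ {e} e∈ → /-≤⁺ {0ℤ} {u e} {0} {d} (subst (0ℤ ℤ.≤_) (sym (ℤ.*-identityʳ (u e))) (0≤u e)) ,
                                    /-≤⁺ {u e} {1ℤ} {d} {0} (subst₂ ℤ._≤_ (sym (ℤ.*-identityʳ (u e))) (sym (ℤ.*-identityˡ (+ suc d))) (u≤d e∈))) ,
           (λ v → ℚ.≤-reflexive (trans (Σℚ-/ (edgesAt Es v) u d) (/-≡⁺ {∑ᶻ (edgesAt Es v) u} {1ℤ} {d} {0}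
             (trans (ℤ.*-identityʳ _) (trans (∑ᶻ-filter (v ∈?_) Es u) (trans (at v) (sym (ℤ.*-identityˡ (+ suc d)))))))))) ,
          trans (Σℚ-/ Es u d) (/-≡⁺ {∑ᶻ Es u} {+ n} {d} {s} weight)
      where
      φ : Subset n → ℚ
      φ e = u e / suc d
      at : ∀ v → ∑ᶻ Es (λ e → u e ℤ.* ∈ᶻ e v) ≡ + suc d
      at v = trans (balanced (∈-allFin v)) (ℤ.*-identityʳ (+ suc d))
      u≤d : ∀ {e} → e ∈ Es → u e ℤ.≤ + suc d
      u≤d {e} e∈ with v , v∈e ← nonempty e (uniform e∈) = begin
        u e                                          ≤⟨ ∑ᶻ-member (λ {e} _ → 0≤u e) (∈-filter⁺ (v ∈?_) e∈ v∈e) ⟩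
        ∑ᶻ (edgesAt Es v) u                          ≡⟨ ∑ᶻ-filter (v ∈?_) Es u ⟩
        ∑ᶻ Es (λ e → u e ℤ.* ∈ᶻ e v)                 ≡⟨ at v ⟩
        + suc d                                      ∎
        where open ℤ.≤-Reasoning
      size : ∀ {e} → e ∈ Es → ∑ᶻ V (∈ᶻ e) ≡ + r
      size {e} e∈ = begin
        ∑ᶻ V (∈ᶻ e)                       ≡⟨ ∑ᶻ-cong V (λ {v} _ → sym (ℤ.*-identityˡ (∈ᶻ e v))) ⟩
        ∑ᶻ V (λ v → 1ℤ ℤ.* ∈ᶻ e v)        ≡⟨ ∑ᶻ-filter (_∈? e) V (λ _ → 1ℤ) ⟨
        ∑ᶻ (verticesOf e) (λ _ → 1ℤ)      ≡⟨ ∑ᶻ-1 (verticesOf e) ⟩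
        + length (verticesOf e)           ≡⟨ cong +_ (trans (length-verticesOf e) (uniform e∈)) ⟩
        + r                               ∎
        where open ≡-Reasoning
      weight : ∑ᶻ Es u ℤ.* + r ≡ + n ℤ.* + suc d
      weight = begin
        ∑ᶻ Es u ℤ.* + r                               ≡⟨ ℤ.*-comm (∑ᶻ Es u) (+ r) ⟩
        + r ℤ.* ∑ᶻ Es u                               ≡⟨ ∑ᶻ-*ˡ Es (+ r) u ⟨
        ∑ᶻ Es (λ e → + r ℤ.* u e)                     ≡⟨ ∑ᶻ-cong Es (λ {e} e∈ → trans (ℤ.*-comm (+ r) (u e)) (cong (u e ℤ.*_) (sym (size e∈)))) ⟩
        ∑ᶻ Es (λ e → u e ℤ.* ∑ᶻ V (∈ᶻ e))             ≡⟨ ∑ᶻ-cong Es (λ {e} _ → sym (∑ᶻ-*ˡ V (u e) (∈ᶻ e))) ⟩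
        ∑ᶻ Es (λ e → ∑ᶻ V (λ v → u e ℤ.* ∈ᶻ e v))     ≡⟨ ∑ᶻ-swap Es V (λ e v → u e ℤ.* ∈ᶻ e v) ⟩
        ∑ᶻ V (λ v → ∑ᶻ Es (λ e → u e ℤ.* ∈ᶻ e v))     ≡⟨ ∑ᶻ-cong V (λ {v} _ → trans (at v) (sym (ℤ.*-identityʳ (+ suc d)))) ⟩
        ∑ᶻ V (λ _ → + suc d ℤ.* 1ℤ)                   ≡⟨ ∑ᶻ-*ˡ V (+ suc d) (λ _ → 1ℤ) ⟩
        + suc d ℤ.* ∑ᶻ V (λ _ → 1ℤ)                   ≡⟨ cong (+ suc d ℤ.*_) (trans (∑ᶻ-1 V) (cong +_ (length-allFin n))) ⟩
        + suc d ℤ.* + n                               ≡⟨ ℤ.*-comm (+ suc d) (+ n) ⟩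
        + n ℤ.* + suc d                               ∎
        where open ≡-Reasoning
    perfect-matching (+ zero , _ , ℤ.+<+ () , _)

    uniform-cover : IsFractionalCover Es (λ _ → 1ℤ / r)
    uniform-cover =
      (λ _ → /-≤⁺ {0ℤ} {1ℤ} {0} {s} (ℤ.+≤+ ℕ.z≤n) , /-≤⁺ {1ℤ} {1ℤ} {s} {0} (ℤ.+≤+ (ℕ.s≤s ℕ.z≤n))) ,
      All.tabulate (λ {e} e∈ → ℚ.≤-reflexive (sym (trans (Σℚ-/ (verticesOf e) (λ _ → 1ℤ) s)
        (/-≡⁺ {∑ᶻ (verticesOf e) (λ _ → 1ℤ)} {1ℤ} {s} {0}
          (trans (ℤ.*-identityʳ _) (trans (∑ᶻ-1 (verticesOf e)) (trans (cong +_ (trans (length-verticesOf e) (uniform e∈))) (sym (ℤ.*-identityˡ (+ r))))))))))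

    cover-unique : ∀ w → IsFractionalCover Es w → coverWeight n w ≡ (+ n) / r → ∀ v → w v ≡ 1ℤ / r
    cover-unique w (_ , covers) weight v with d , W , w≡ ← common-denominator w =
      trans (w≡ v) (/-≡⁺ {W v} {1ℤ} {d} {s} (trans (ℤ.*-comm (W v) (+ r)) (trans rW≡D (sym (ℤ.*-identityˡ (+ suc d))))))
      where
      g : Fin n → ℤ
      -- A positive multiple of `w - 1/r`; the factor `1ℤ` gives the shape that `∑ᶻ-linear` expects.
      g v = + r ℤ.* W v ℤ.+ ℤ.- (+ suc d) ℤ.* 1ℤ
      Σ≡ : ∀ xs → Σℚ (map w xs) ≡ ∑ᶻ xs W / suc d
      Σ≡ xs = trans (Σℚ-cong xs w≡) (Σℚ-/ xs W d)
      ∑g : ∀ xs → ∑ᶻ xs g ≡ + r ℤ.* ∑ᶻ xs W ℤ.- + suc d ℤ.* + length xs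
      ∑g xs = trans (∑ᶻ-linear xs (+ r) (ℤ.- (+ suc d)) W (λ _ → 1ℤ))
        (cong (ℤ._+_ (+ r ℤ.* ∑ᶻ xs W)) (trans (cong (ℤ._*_ (ℤ.- (+ suc d))) (∑ᶻ-1 xs)) (sym (ℤ.neg-distribˡ-* (+ suc d) (+ length xs)))))
      edge-nonNeg : ∀ {e} → e ∈ Es → 0ℤ ℤ.≤ ∑ᶻ (verticesOf e) g
      edge-nonNeg {e} e∈ = subst (0ℤ ℤ.≤_) (sym (∑g (verticesOf e))) (ℤ.i≤j⇒0≤j-i (begin
        + suc d ℤ.* + length (verticesOf e)   ≡⟨ cong (λ l → + suc d ℤ.* + l) (trans (length-verticesOf e) (uniform e∈)) ⟩
        + suc d ℤ.* + r                       ≡⟨ ℤ.*-comm (+ suc d) (+ r) ⟩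
        + r ℤ.* + suc d                       ≤⟨ ℤ.*-monoˡ-≤-nonNeg (+ r) D≤ ⟩
        + r ℤ.* ∑ᶻ (verticesOf e) W           ∎))
        where
        open ℤ.≤-Reasoning
        D≤ : + suc d ℤ.≤ ∑ᶻ (verticesOf e) W
        D≤ = subst₂ ℤ._≤_ (ℤ.*-identityˡ (+ suc d)) (ℤ.*-identityʳ _)
          (/-≤⁻ {1ℤ} {∑ᶻ (verticesOf e) W} {0} {d} (subst (1ℚ ℚ.≤_) (Σ≡ (verticesOf e)) (All.lookup covers e∈)))
      total≡0 : ∑ᶻ V g ≡ 0ℤ
      total≡0 = trans (∑g V) (ℤ.i≡j⇒i-j≡0 (begin
        + r ℤ.* ∑ᶻ V W                ≡⟨ ℤ.*-comm (+ r) (∑ᶻ V W) ⟩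
        ∑ᶻ V W ℤ.* + r                ≡⟨ /-≡⁻ {∑ᶻ V W} {+ n} {d} {s} (trans (sym (Σ≡ V)) weight) ⟩
        + n ℤ.* + suc d               ≡⟨ ℤ.*-comm (+ n) (+ suc d) ⟩
        + suc d ℤ.* + n               ≡⟨ cong (λ l → + suc d ℤ.* + l) (length-allFin n) ⟨
        + suc d ℤ.* + length V        ∎))
        where open ≡-Reasoning
      g≡0 : ∀ v → g v ≡ 0ℤ
      g≡0 = Balance.total-zero s Es uniform expanding g edge-nonNeg (ℤ.≤-reflexive total≡0)
      rW≡D : + r ℤ.* W v ≡ + suc d
      rW≡D = ℤ.i-j≡0⇒i≡j (+ r ℤ.* W v) (+ suc d)
        (trans (cong (ℤ._+_ (+ r ℤ.* W v)) (sym (ℤ.*-identityʳ (ℤ.- (+ suc d))))) (g≡0 v))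

    expanding⇒good : GoodProperty n r Es
    expanding⇒good with farkas Es Es! ∈ᶻ (λ _ → 1ℤ)
    ... | inj₁ conic = perfect-matching conic , uniform-cover , cover-unique
    ... | inj₂ separated = contradiction separated not-separated

-- Unobstructed outcomes are good, and they fill almost the whole space.

module Conclusion where

  open import Data.Bool using (Bool; true; false; not; T; T?)
  open import Data.Bool.ListAction using (all; any)
  open import Data.Bool.Properties using (T-∧)
  open import Data.Fin using (Fin; zero; suc)
  open import Data.Fin.Subset using (Subset; ∣_∣) renaming (_∈_ to _∈ˢ_)
  open import Data.Fin.Subset.Properties using (∣p∣≤n)
  open import Data.List as List using (List; []; _∷_; length; filter; _++_)
  open import Data.List.Membership.Propositional using (_∈_; lose)
  open import Data.List.Membership.Propositional.Properties
    using (∈-filter⁺; ∈-filter⁻; ∈-++⁺ˡ; ∈-++⁺ʳ; ∈-++⁻; ∈-upTo⁺; ∈-concat⁺′; ∈-concat⁻′; ∈-deduplicate⁺; ∈-deduplicate⁻; ∈-cartesianProduct⁺)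
  open import Data.List.Properties using (length-++)
  open import Data.List.Relation.Unary.All as All using (All; []; _∷_)
  open import Data.List.Relation.Unary.Any using (here; there)
  open import Data.List.Relation.Unary.Any.Properties using (any⁺)
  open import Data.List.Relation.Unary.Unique.Propositional using (Unique)
  open import Data.List.Relation.Unary.Unique.Propositional.Properties using (filter⁺; ++⁺)
  import Data.List.Relation.Unary.Unique.DecPropositional as DecUnique
  open import Data.List.Relation.Unary.Unique.DecPropositional.Properties using (deduplicate-!)
  open import Data.Nat using (ℕ; zero; suc; _+_; _*_; _≤_; _<_; _≥_; s≤s; NonZero; ≢-nonZero⁻¹)
  open import Data.Nat.Combinatorics using (_C_)
  open import Data.Nat.Properties using (≤-trans; ≤-reflexive; m≤m+n; m≤n+m; *-comm; *-monoˡ-≤; ≡⇒≡ᵇ; ≤⇒≤ᵇ; <⇒≱; module ≤-Reasoning)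
  open import Data.Product using (∃; _×_; _,_; proj₁; proj₂)
  open import Data.Sum using (inj₁; inj₂)
  open import Data.Vec as Vec using (Vec; []; _∷_; lookup; tabulate; toList; here; there)
  open import Data.Vec.Properties using (lookup∘tabulate)
  open import Function using (_∘_; Equivalence)
  open import Relation.Binary.PropositionalEquality using (_≡_; refl; sym; trans; cong; cong₂; subst)
  open import Relation.Nullary using (¬_; ¬?; yes; no; contradiction)
  open import Defs
  open HitProbability using (HitBound; hit-bound)
  open Counting
  open Enumeration
  open UnionBound
  open LayerCake
  open FractionalDuality

  private variable
    A : Set

  ∈-toList⁺ : ∀ {n} (ω : Vec A n) i → lookup ω i ∈ toList ω
  ∈-toList⁺ (x ∷ ω) zero = here refl
  ∈-toList⁺ (x ∷ ω) (suc i) = there (∈-toList⁺ ω i)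

  ∈-toList⁻ : ∀ {n} (ω : Vec A n) {x} → x ∈ toList ω → ∃ λ i → x ≡ lookup ω i
  ∈-toList⁻ (x ∷ ω) (here refl) = zero , refl
  ∈-toList⁻ (x ∷ ω) (there x∈) = suc (proj₁ (∈-toList⁻ ω x∈)) , proj₂ (∈-toList⁻ ω x∈)

  ∈-edges⁺ : ∀ {n} (ω : Outcome n) v {e} → e ∈ lookup ω v → e ∈ edges ω
  ∈-edges⁺ ω v e∈ = ∈-deduplicate⁺ _≟ₛ_ (∈-concat⁺′ e∈ (∈-toList⁺ ω v))

  ∈-edges⁻ : ∀ {n} (ω : Outcome n) {e} → e ∈ edges ω → ∃ λ v → e ∈ lookup ω v
  ∈-edges⁻ ω e∈ with L , e∈L , L∈ ← ∈-concat⁻′ (toList ω) (∈-deduplicate⁻ _≟ₛ_ (List.concat (toList ω)) e∈)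
    with v , refl ← ∈-toList⁻ ω L∈ = v , e∈L

  any-false : ∀ (p : A → Bool) xs → ¬ T (all (not ∘ p) xs) → ∃ λ x → x ∈ xs × T (p x)
  any-false p [] ¬all = contradiction _ ¬all
  any-false p (x ∷ xs) ¬all with p x in eq
  ... | true = x , here refl , subst T (sym eq) _
  ... | false with y , y∈ , py ← any-false p xs ¬all = y , there y∈ , py

  allOn-false : ∀ {n} (q : A → Bool) (S : Subset n) (ω : Vec A n) → ¬ T (allOn q S ω) → ∃ λ v → v ∈ˢ S × ¬ T (q (lookup ω v))
  allOn-false q [] [] ¬all = contradiction _ ¬all
  allOn-false q (false ∷ S) (x ∷ ω) ¬all with v , v∈ , ¬q ← allOn-false q S ω ¬all = suc v , there v∈ , ¬q
  allOn-false q (true ∷ S) (x ∷ ω) ¬all with q x in eq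
  ... | false = zero , here , subst T eq
  ... | true with v , v∈ , ¬q ← allOn-false q S ω ¬all = suc v , there v∈ , ¬q

  module _ (s k L : ℕ) (k≤C : k ≤ L C s) where
    open Model s k L
    open DecUnique (_≟ₛ_ {suc L}) using (unique?)
    open Distinct (_≟ₛ_ {suc L}) using (length-⊆)

    private
      n = suc L
      r = suc s

    choices-valid : ∀ v {E} → E ∈ choices v → ValidChoice n r k v E
    choices-valid v E∈ with E∈′ , E! ← ∈-filter⁻ unique? {xs = words k (through v s)} E∈ =
      E! , All.map (∈-through⁻ v s) (proj₂ (∈-words⁻ k E∈′)) , inj₁ (proj₁ (∈-words⁻ k E∈′))

    valid-choices : ∀ v {E} → ValidChoice n r k v E → E ∈ choices v
    valid-choices v (E! , E⊆ , inj₁ refl) =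
      ∈-filter⁺ unique? (∈-words⁺ (All.map (λ { (size , v∈) → ∈-through⁺ size v∈ }) E⊆)) E!
    -- A duplicate-free list containing every edge through `v` has at least `L C s ≥ k` entries, so
    -- it is not short.
    valid-choices v (E! , E⊆ , inj₂ (short , full)) = contradiction
      (≤-trans k≤C (≤-trans (≤-reflexive (sym (length-through v s))) (length-⊆ E! (through-unique v s)
        (All.tabulate λ e∈ → full _ (proj₁ (∈-through⁻ v s e∈)) (proj₂ (∈-through⁻ v s e∈))))))
      (<⇒≱ short)

    outcomes-valid : ∀ {ω} → ω ∈ outcomes → ValidOutcome n r k ω
    outcomes-valid ω∈ v = choices-valid v (subst (_ ∈_) (lookup∘tabulate choices v) (∈-tuples⁻ (tabulate choices) ω∈ v))

    valid-outcomes : ∀ ω → ValidOutcome n r k ω → ω ∈ outcomes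
    valid-outcomes ω valid = ∈-tuples⁺ (tabulate choices)
      (λ v → subst (_ ∈_) (sym (lookup∘tabulate choices v)) (valid-choices v (valid v)))

    outcomes-unique : Unique outcomes
    outcomes-unique = tuples-unique (tabulate choices)
      (λ v → subst Unique (sym (lookup∘tabulate choices v)) (filter⁺ unique? (words-unique k (through-unique v s))))

    avoided⇒obstructed : ∀ ω S U → 1 ≤ ∣ S ∣ → ∣ U ∣ ≤ r * ∣ S ∣ → T (disjoint S U) →
                         T (allOn (all (hits U)) S ω) → T (obstructed ω)
    avoided⇒obstructed ω S U 1≤S U≤rS S#U avoided with ∣ S ∣ in size | 1≤S | U≤rS
    ... | suc a | _ | U≤ = any⁺ _ (lose (∈-upTo⁺ a<n) (any⁺ _ (lose pair∈
            (Equivalence.from T-∧ (Equivalence.from T-∧ (≡⇒≡ᵇ ∣ S ∣ (suc a) size ,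
              Equivalence.from T-∧ (≤⇒≤ᵇ U≤ , S#U)) , avoided)))))
      where
      a<n : a < n
      a<n = subst (_≤ n) size (∣p∣≤n S)
      pair∈ : (S , U) ∈ pairs (suc a)
      pair∈ = ∈-cartesianProduct⁺ (∈-atMost S (≤-reflexive size)) (∈-atMost U U≤)

    -- Some vertex of `S` drew an edge avoiding `U`, and that edge meets `S` in the vertex that drew
    -- it.
    unobstructed⇒expanding : ∀ {ω} → ValidOutcome n r k ω → ¬ T (obstructed ω) → Expanding r (edges ω)
    unobstructed⇒expanding {ω} valid ¬obstructed S U 1≤S U≤rS S#U
      with v , v∈S , ¬all ← allOn-false (all (hits U)) S ω (¬obstructed ∘ avoided⇒obstructed ω S U 1≤S U≤rS S#U)
      with e , e∈ , e#U ← any-false (λ e → disjoint e U) (lookup ω v) ¬all =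
      e , ∈-edges⁺ ω v e∈ , e#U , v , v∈S , proj₂ (All.lookup (proj₁ (proj₂ (valid v))) e∈)

    unobstructed⇒good : ∀ {ω} → ω ∈ outcomes → ¬ T (obstructed ω) → GoodProperty n r (edges ω)
    unobstructed⇒good {ω} ω∈ ¬obstructed = expanding⇒good s (edges ω) (deduplicate-! _≟ₛ_ (List.concat (toList ω)))
      (λ e∈ → let v , e∈v = ∈-edges⁻ ω e∈ in proj₁ (All.lookup (proj₁ (proj₂ (valid v))) e∈v))
      (unobstructed⇒expanding {ω} valid ¬obstructed)
      where valid = outcomes-valid ω∈

    -- The obstructed outcomes serve as the bad list; their fraction is at most `1/n`, and
    -- `suc m ≤ n`.
    probably-good : 1 ≤ k → HitBound s k L → ∀ m → suc m ≤ n → ProbAtLeast n r k m (λ ω → GoodProperty n r (edges ω))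
    probably-good 1≤k hit m m<n = good , bad ,
      ++⁺ (filter⁺ good? outcomes-unique) (filter⁺ bad? outcomes-unique)
        (λ { (ω∈good , ω∈bad) → proj₂ (∈-filter⁻ good? {xs = outcomes} ω∈good) (proj₂ (∈-filter⁻ bad? {xs = outcomes} ω∈bad)) }) ,
      All.tabulate (outcomes-valid ∘ listed) ,
      (λ ω valid → covered (valid-outcomes ω valid)) ,
      All.tabulate (λ ω∈ → let ω∈′ , ¬obs = ∈-filter⁻ good? {xs = outcomes} ω∈ in unobstructed⇒good ω∈′ ¬obs) ,
      (begin
        suc m * length bad                    ≤⟨ *-monoˡ-≤ (length bad) m<n ⟩
        n * length bad                        ≡⟨ *-comm n (length bad) ⟩
        length bad * n                        ≡⟨ cong (_* n) (length-filter≡count bad? outcomes) ⟩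
        count obstructed outcomes * n         ≤⟨ count-obstructed 1≤k k≤C hit ⟩
        length outcomes                       ≡⟨ count-not obstructed outcomes ⟨
        count (not ∘ obstructed) outcomes + count obstructed outcomes
          ≡⟨ cong₂ _+_ (length-filter≡count good? outcomes) (length-filter≡count bad? outcomes) ⟨
        length good + length bad              ≡⟨ length-++ good ⟨
        length (good ++ bad)                  ∎)
      where
      open ≤-Reasoning
      bad? = λ ω → T? (obstructed ω)
      good? = λ ω → ¬? (bad? ω)
      good = filter good? outcomes
      bad = filter bad? outcomes
      listed : ∀ {ω} → ω ∈ good ++ bad → ω ∈ outcomes
      listed ω∈ with ∈-++⁻ good ω∈
      ... | inj₁ ω∈good = proj₁ (∈-filter⁻ good? {xs = outcomes} ω∈good)
      ... | inj₂ ω∈bad = proj₁ (∈-filter⁻ bad? {xs = outcomes} ω∈bad)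
      covered : ∀ {ω} → ω ∈ outcomes → ω ∈ good ++ bad
      covered {ω} ω∈ with bad? ω
      ... | yes obs = ∈-++⁺ʳ good (∈-filter⁺ bad? ω∈ obs)
      ... | no ¬obs = ∈-++⁺ˡ (∈-filter⁺ good? ω∈ ¬obs)

open import Data.Nat using (zero; suc; s≤s; _+_; ≢-nonZero⁻¹)
open import Data.Nat.Properties using (≤-trans; m≤m+n; m≤n+m)
open import Data.Product using (_,_)
open import Relation.Binary.PropositionalEquality using (refl)
open import Relation.Nullary using (contradiction)

open HitProbability using (hit-bound)
open Conclusion using (probably-good)

theorem1 : (r : ℕ) → .{{_ : NonZero r}} →
    ∃ λ (k : ℕ) → k ≥ 1 ×
    ((m : ℕ) → ∃ λ (N : ℕ) → (n : ℕ) → n ≥ N →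
    ProbAtLeast n r k m (λ ω → GoodProperty n r (edges ω)))
theorem1 zero = contradiction refl (≢-nonZero⁻¹ 0)
-- In the threshold, `N` makes the hit bound available, `m` brings `1/n` below `1/(m+1)`, and the
-- successor lets `n` be written as `suc L`.
theorem1 (suc s) with k , 1≤k , N , eventually ← hit-bound s = k , 1≤k , λ m → suc (N + m) , λ where
  (suc L) (s≤s N+m≤L) → let k≤C , hit = eventually L (≤-trans (m≤m+n N m) N+m≤L) in
    probably-good s k L k≤C 1≤k hit m (s≤s (≤-trans (m≤n+m m N) N+m≤L))
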